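{- For every integer $n\ge 1$, $$\delta(n)=\min_{0\le v\le n}\{\delta_P(v)+\delta_C(n-v)\}=n+2+2\min_{0\le v\le n}\{C(v)-T(n-v)-v\}.$$
   Context: $\mathcal{T}_\infty$ is the infinite binary tree with all leaves at the same level: its vertices are the pairs $(i,j)$ of integers with $i\ge 1$, $j\ge 0$; the vertex $(i,j)$ has parent $(i+1,\lfloor j/2\rfloor)$, and the edges join each vertex to its parent. For a finite vertex set $S$, $\overline S$ is its complement and $(S,\overline S)$ is the set of edges with one end in $S$ and the other in $\overline S$. For $n\ge 1$: $\delta(n)$ is the minimum of $|(S,\overline S)|$ over all $S\subset V(\mathcal{T}_\infty)$ with $|S|=n$; $\delta_C(n)$ is the minimum over those $S$ with $|S|=n$ that induce a connected subgraph; $\delta_P(n)$ is the minimum over those $S$ with $|S|=n$ for which $\overline S$ induces a connected subgraph. By convention $\delta_P(0)=\delta_C(0)=0$. Tanny sequence: $T(0)=T(1)=T(2)=1$ and $T(n)=T(n-1-T(n-1))+T(n-2-T(n-2))$ for $n>2$. Conolly sequence: $C(0)=0$, $C(1)=1$, $C(2)=2$ and $C(n)=C(n-C(n-1))+C(n-1-C(n-2))$ for $n>2$. -}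

module Defs where

open import Data.Integer as ℤ using (ℤ)
import Data.Integer.Properties as ℤ
import Data.List.Extrema
import Data.List.Extrema.Nat as ℕExtrema
open import Data.List.Base using (List; []; _∷_; map; concatMap; filter; length; upTo)
open import Data.List.Membership.Propositional using (_∈_; _∉_)
import Data.List.Membership.DecPropositional as DecMembership
open import Data.List.Relation.Unary.Any using (here; there)
open import Data.List.Relation.Unary.Unique.Propositional using (Unique)
open import Data.Nat.Base using (ℕ; zero; suc; _+_; _*_; _∸_; _≤_; ⌊_/2⌋)
open import Data.Nat.Properties as ℕ using (+-suc)
open import Data.Product.Base using (∃; _×_; _,_; proj₁; proj₂)
open import Data.Product.Properties using (≡-dec)
open import Data.Sum.Base using (_⊎_; inj₁; inj₂)
open import Data.Unit.Base using (⊤)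
open import Function.Base using (_∘_)
open import Function.Bundles using (_⇔_; mk⇔; module Equivalence)
open import Relation.Binary.Construct.Closure.ReflexiveTransitive using (Star)
open import Relation.Binary.Definitions using (DecidableEquality)
open import Relation.Binary.PropositionalEquality.Core using (_≡_; refl; sym; cong)
open import Relation.Nullary.Decidable.Core using (¬?)

-- Levels are counted from 0: the pair (i , j) is the vertex (i + 1, j) of the
-- tree 𝒯∞, so the leaves are the vertices (0 , j).
Vertex : Set
Vertex = ℕ × ℕ

_≟ⱽ_ : DecidableEquality Vertex
_≟ⱽ_ = ≡-dec ℕ._≟_ ℕ._≟_

open DecMembership _≟ⱽ_ using (_∈?_)

parent : Vertex → Vertex
parent (i , j) = suc i , ⌊ j /2⌋

Adjacent : Vertex → Vertex → Set
Adjacent x y = parent x ≡ y ⊎ parent y ≡ x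

children : Vertex → List Vertex
children (zero  , j) = []
children (suc i , j) = (i , 2 * j) ∷ (i , suc (2 * j)) ∷ []

neighbours : Vertex → List Vertex
neighbours x = parent x ∷ children x

private
  ⌊2*n/2⌋ : ∀ n → ⌊ 2 * n /2⌋ ≡ n
  ⌊2*n/2⌋ zero    = refl
  ⌊2*n/2⌋ (suc n) rewrite +-suc n (n + 0) = cong suc (⌊2*n/2⌋ n)

  ⌊1+2*n/2⌋ : ∀ n → ⌊ suc (2 * n) /2⌋ ≡ n
  ⌊1+2*n/2⌋ zero    = refl
  ⌊1+2*n/2⌋ (suc n) rewrite +-suc n (n + 0) = cong suc (⌊1+2*n/2⌋ n)

  halve : ∀ j → j ≡ 2 * ⌊ j /2⌋ ⊎ j ≡ suc (2 * ⌊ j /2⌋)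
  halve zero          = inj₁ refl
  halve (suc zero)    = inj₂ refl
  halve (suc (suc j)) rewrite +-suc ⌊ j /2⌋ (⌊ j /2⌋ + 0) with halve j
  ... | inj₁ p = inj₁ (cong (suc ∘ suc) p)
  ... | inj₂ p = inj₂ (cong (suc ∘ suc) p)

∈-children⇔ : ∀ x y → y ∈ children x ⇔ parent y ≡ x
∈-children⇔ x y = mk⇔ (to x) from
  where
  to : ∀ x → y ∈ children x → parent y ≡ x
  to (suc i , j) (here refl)         = cong (suc i ,_) (⌊2*n/2⌋ j)
  to (suc i , j) (there (here refl)) = cong (suc i ,_) (⌊1+2*n/2⌋ j)

  from : parent y ≡ x → y ∈ children x
  from refl with halve (proj₂ y)
  ... | inj₁ p = here (cong (proj₁ y ,_) p)
  ... | inj₂ p = there (here (cong (proj₁ y ,_) p))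

∈-neighbours⇔ : ∀ x y → y ∈ neighbours x ⇔ Adjacent x y
∈-neighbours⇔ x y = mk⇔ to from
  where
  open Equivalence (∈-children⇔ x y) renaming (to to child→; from to child←)

  to : y ∈ neighbours x → Adjacent x y
  to (here p)  = inj₁ (sym p)
  to (there p) = inj₂ (child→ p)

  from : Adjacent x y → y ∈ neighbours x
  from (inj₁ p) = here (sym p)
  from (inj₂ p) = there (child← p)

-- A finite vertex set is a list without repetitions.  An edge with exactly one
-- end in S is listed once, as the pair (x , y) with x ∈ S and y ∉ S.
cut : List Vertex → List (Vertex × Vertex)
cut S = concatMap (λ x → map (x ,_) (filter (λ y → ¬? (y ∈? S)) (neighbours x))) S

InducesConnected : (Vertex → Set) → Set
InducesConnected P = ∀ x y → P x → P y → Star (λ a b → P a × P b × Adjacent a b) x y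

Unrestricted Connected CoConnected : List Vertex → Set
Unrestricted S = ⊤
Connected    S = InducesConnected (_∈ S)
CoConnected  S = InducesConnected (_∉ S)

CutSize : (List Vertex → Set) → ℕ → ℕ → Set
CutSize Q n k = ∃ λ S → Unique S × length S ≡ n × Q S × length (cut S) ≡ k

IsMinimum : (ℕ → Set) → ℕ → Set
IsMinimum P m = P m × (∀ k → P k → m ≤ k)

-- Each function is determined by these fields, except for δ at 0.
record CutMinima : Set where
  field
    δ δP δC : ℕ → ℕ
    δ-min   : ∀ n → 1 ≤ n → IsMinimum (CutSize Unrestricted n) (δ n)
    δP-min  : ∀ n → 1 ≤ n → IsMinimum (CutSize CoConnected n) (δP n)
    δC-min  : ∀ n → 1 ≤ n → IsMinimum (CutSize Connected n) (δC n)
    δP-zero : δP 0 ≡ 0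
    δC-zero : δC 0 ≡ 0

-- The first argument of tanny and conolly is fuel.  Every nested call is at an
-- argument smaller than n, so fuel n + 1 is never exhausted when computing the
-- n-th term.  In both sequences the subtractions are never truncated by _∸_.
tanny : ℕ → ℕ → ℕ
tanny zero       _ = 0
tanny (suc fuel) 0 = 1
tanny (suc fuel) 1 = 1
tanny (suc fuel) 2 = 1
tanny (suc fuel) n@(suc (suc (suc _))) = t (n ∸ 1 ∸ t (n ∸ 1)) + t (n ∸ 2 ∸ t (n ∸ 2))
  where
  t : ℕ → ℕ
  t = tanny fuel

T : ℕ → ℕ
T n = tanny (suc n) n

conolly : ℕ → ℕ → ℕ
conolly zero       _ = 0
conolly (suc fuel) 0 = 0
conolly (suc fuel) 1 = 1
conolly (suc fuel) 2 = 2
conolly (suc fuel) n@(suc (suc (suc _))) = c (n ∸ c (n ∸ 1)) + c (n ∸ 1 ∸ c (n ∸ 2))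
  where
  c : ℕ → ℕ
  c = conolly fuel

C : ℕ → ℕ
C n = conolly (suc n) n

_ : map T (upTo 14) ≡ 1 ∷ 1 ∷ 1 ∷ 2 ∷ 2 ∷ 2 ∷ 3 ∷ 4 ∷ 4 ∷ 4 ∷ 4 ∷ 5 ∷ 6 ∷ 6 ∷ []
_ = refl

_ : map C (upTo 14) ≡ 0 ∷ 1 ∷ 2 ∷ 2 ∷ 3 ∷ 4 ∷ 4 ∷ 4 ∷ 5 ∷ 6 ∷ 6 ∷ 7 ∷ 8 ∷ 8 ∷ []
_ = refl

-- Minimum of f v over 0 ≤ v ≤ n; the library's min takes a default element.
min≤ : ℕ → (ℕ → ℕ) → ℕ
min≤ n f = ℕExtrema.min (f 0) (map f (upTo (suc n)))

min≤ℤ : ℕ → (ℕ → ℤ) → ℤ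
min≤ℤ n f = ℤExtrema.min (f 0) (map f (upTo (suc n)))
  where module ℤExtrema = Data.List.Extrema ℤ.≤-totalOrder

{-# OPTIONS --safe #-}
-- Write L, K and n for the numbers of leaves, of components and of vertices of a
-- finite set S; K is the number of vertices of S whose parent is not in S.  Then
-- |(S, S̄)| = n + 2K − 2L.
--
-- Let σ e x = Σ (⌊x/2ⁱ⌋ + e) over the i with ⌊x/2ⁱ⌋ > 0.  Both sequences count the
-- values of σ below n: C n = #{x | σ 0 x < n} and T n = #{x | σ 1 x < n} for n ≥ 1,
-- because the even and the odd x in the count are governed by the two summands of
-- the recursion.
--
-- If aᵢ counts the vertices of S at level i, and cᵢ those whose parent is not in S,
-- then aᵢ − cᵢ ≤ 2aᵢ₊₁.  Going down level by level, any such sequence is dominated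
-- by one connected set and a union of full subtrees: doubling all leaves below a
-- level and, for odd aᵢ − cᵢ, deleting a leaf of the connected part costs nothing.
-- A connected set has K = 1, which forces n > σ 1 (L − 1); a set closed under
-- children has 2aᵢ₊₁ ≤ aᵢ, which forces n ≤ σ 0 L.
--
-- All bounds are attained by sets { (i , j) | j < wᵢ }: halving the widths wᵢ rounded
-- up gives connected sets, rounded down (at most) gives sets with connected
-- complement, and adding two width sequences gives the sets for δ.
module Submission where

open import Defs
import Data.Integer.Properties as ℤ
import Data.Integer.Tactic.RingSolver as ℤ-Solver
import Data.List.Extrema
import Data.List.Extrema.Nat as ℕExtrema
open import Data.Integer.Base as ℤ using (ℤ)
open import Data.List.Base using (List; []; _∷_; _++_; map; concatMap; filter; length; upTo)
open import Data.List.Membership.Propositional using (_∈_; _∉_)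
open import Data.List.Membership.Propositional.Properties
import Data.List.Membership.DecPropositional as DecMembership
open import Data.List.Properties
  using (length-++; length-map; length-upTo; filter-++; filter-none; filter-accept; filter-reject)
open import Data.List.Relation.Unary.All as All using ([]; _∷_)
open import Data.List.Relation.Unary.AllPairs using ([]; _∷_)
open import Data.List.Relation.Unary.Any as Any using (here; there)
open import Data.List.Relation.Unary.Unique.Propositional using (Unique)
import Data.List.Relation.Unary.Unique.Propositional.Properties as Unique
open import Data.Nat.Base hiding (_+_; _*_)
open import Data.Nat.Induction using (<-rec)
open import Data.Nat.ListAction using (sum)
open import Data.Nat.Properties
open import Data.Nat.Tactic.RingSolver using (solve-∀)
open import Data.Product.Base using (∃; _,_; proj₁; proj₂)
open import Data.Sum.Base using (_⊎_; inj₁; inj₂)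
open import Data.Unit.Base using (tt)
open import Function.Base using (_∘_; id)
open import Function.Bundles using (module Equivalence)
open import Relation.Binary.Construct.Closure.ReflexiveTransitive using (Star; ε; _◅_; _◅◅_; reverse)
open import Relation.Binary.Definitions using (tri<; tri≈; tri>)
open import Relation.Binary.PropositionalEquality
open import Relation.Nullary using (yes; no; contradiction; ¬_)
open import Relation.Nullary.Decidable.Core using (¬?)
open import Relation.Unary using (Pred; Decidable)

open DecMembership _≟ⱽ_ using (_∈?_)

-- Halving, the functions `σ e` and their counting functions.

module Sequences where

  open import Data.Nat.Base using (_+_; _*_)
  open import Data.Product.Base using (_×_)

  halving-rec : ∀ {p} (P : ℕ → Set p) → P 0 → (∀ x → P ⌊ suc x /2⌋ → P (suc x)) → ∀ x → P x
  halving-rec P base step = <-rec P λ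
    { zero    _  → base
    ; (suc x) ih → step x (ih (⌊n/2⌋<n x))
    }

  below⇒≤ : ∀ {a b} → (∀ y → y < a → y < b) → a ≤ b
  below⇒≤ {a} {b} f = ≮⇒≥ λ b<a → <-irrefl refl (f b b<a)

  -- `⌊ n /2⌋` counts the odd numbers below `n`; since `⌈ n /2⌉` is `⌊ suc n /2⌋`, the same two
  -- lemmas at `suc n` count the even ones.
  below-⌊/2⌋ : ∀ y n → y < ⌊ n /2⌋ → suc (y + y) < n
  below-⌊/2⌋ zero    (suc (suc n)) _       = s≤s (s≤s z≤n)
  below-⌊/2⌋ (suc y) (suc (suc n)) (s≤s p) rewrite +-suc y y = s≤s (s≤s (below-⌊/2⌋ y n p))

  ⌊/2⌋-below : ∀ y n → suc (y + y) < n → y < ⌊ n /2⌋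
  ⌊/2⌋-below zero    (suc (suc n)) _ = s≤s z≤n
  ⌊/2⌋-below (suc y) (suc (suc n)) (s≤s (s≤s p)) rewrite +-suc y y = s≤s (⌊/2⌋-below y n p)
  ⌊/2⌋-below zero    1 (s≤s ())
  ⌊/2⌋-below (suc y) 1 (s≤s ())

  ⌊/2⌋-double : ∀ m → ⌊ m /2⌋ + ⌊ m /2⌋ ≤ m
  ⌊/2⌋-double m = ≤-trans (+-monoʳ-≤ ⌊ m /2⌋ (⌊n/2⌋≤⌈n/2⌉ m)) (≤-reflexive (⌊n/2⌋+⌈n/2⌉≡n m))

  -- σ e x = Σ (⌊x/2ⁱ⌋ + e) over the i with ⌊x/2ⁱ⌋ > 0.
  σ-fuel : ℕ → ℕ → ℕ → ℕ
  σ-fuel e zero    _       = 0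
  σ-fuel e (suc f) zero    = 0
  σ-fuel e (suc f) (suc x) = e + suc x + σ-fuel e f ⌊ suc x /2⌋

  σ : ℕ → ℕ → ℕ
  σ e x = σ-fuel e x x

  module _ (e : ℕ) where

    σ-fuel-irrelevant : ∀ {f g} x → x ≤ f → x ≤ g → σ-fuel e f x ≡ σ-fuel e g x
    σ-fuel-irrelevant {zero}  {zero}  zero    _ _ = refl
    σ-fuel-irrelevant {zero}  {suc g} zero    _ _ = refl
    σ-fuel-irrelevant {suc f} {zero}  zero    _ _ = refl
    σ-fuel-irrelevant {suc f} {suc g} zero    _ _ = refl
    σ-fuel-irrelevant {suc f} {suc g} (suc x) (s≤s p) (s≤s q) =
      cong (e + suc x +_) (σ-fuel-irrelevant ⌊ suc x /2⌋ (≤-trans h p) (≤-trans h q))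
      where
      h : ⌊ suc x /2⌋ ≤ x
      h = ≤-pred (⌊n/2⌋<n x)

    σ-suc : ∀ x → σ e (suc x) ≡ e + suc x + σ e ⌊ suc x /2⌋
    σ-suc x = cong (e + suc x +_) (σ-fuel-irrelevant ⌊ suc x /2⌋ (≤-pred (⌊n/2⌋<n x)) ≤-refl)

    σ-even : ∀ y → σ e (suc y + suc y) ≡ e + (suc y + suc y) + σ e (suc y)
    σ-even y = trans (σ-suc (y + suc y))
                     (cong (λ h → e + (suc y + suc y) + σ e h) (sym (n≡⌊n+n/2⌋ (suc y))))

    σ-odd : ∀ y → σ e (suc (y + y)) ≡ e + suc (y + y) + σ e y
    σ-odd y = trans (σ-suc (y + y))
                    (cong (λ h → e + suc (y + y) + σ e h) (sym (n≡⌈n+n/2⌉ y)))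

    σ-even-≤ : ∀ y → σ e (y + y) ≤ e + (y + y) + σ e y
    σ-even-≤ zero    = z≤n
    σ-even-≤ (suc y) = ≤-reflexive (σ-even y)

    σ-mono : ∀ {x y} → x ≤ y → σ e x ≤ σ e y
    σ-mono {x} {y} = halving-rec (λ y → ∀ {x} → x ≤ y → σ e x ≤ σ e y) (λ { z≤n → z≤n }) step y
      where
      step : ∀ y → (∀ {x} → x ≤ ⌊ suc y /2⌋ → σ e x ≤ σ e ⌊ suc y /2⌋) → ∀ {x} → x ≤ suc y → σ e x ≤ σ e (suc y)
      step y ih {zero}  _ = z≤n
      step y ih {suc x} p rewrite σ-suc x | σ-suc y =
        +-mono-≤ (+-monoʳ-≤ e p) (ih (⌊n/2⌋-mono p))

    σ-mono-< : ∀ {x y} → x < y → σ e x < σ e y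
    σ-mono-< {zero}  {suc y} _ rewrite σ-suc y | +-suc e y = z<s
    σ-mono-< {suc x} {suc y} p rewrite σ-suc x | σ-suc y =
      +-mono-<-≤ (+-monoʳ-< e p) (σ-mono (⌊n/2⌋-mono (<⇒≤ p)))

    x≤σ : ∀ x → x ≤ σ e x
    x≤σ zero    = z≤n
    x≤σ (suc x) = ≤-trans (s≤s (x≤σ x)) (σ-mono-< (n<1+n x))

    -- Number of `x` with `σ e x < n`. As `σ e` is strictly increasing, these `x` form an initial
    -- segment, and `count n` is the only candidate that can join at the next step.
    count : ℕ → ℕ
    count zero    = 0
    count (suc n) with σ e (count n) ≤? n
    ... | yes _ = suc (count n)
    ... | no  _ = count n

    count-sound : ∀ n {x} → x < count n → σ e x < n
    count-sound (suc n) {x} p with σ e (count n) ≤? n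
    ... | no  _ = m<n⇒m<1+n (count-sound n p)
    ... | yes q with m≤n⇒m<n∨m≡n (≤-pred p)
    ...   | inj₁ x<k  = m<n⇒m<1+n (count-sound n x<k)
    ...   | inj₂ refl = s≤s q

    count-complete : ∀ n {x} → σ e x < n → x < count n
    count-complete (suc n) {x} (s≤s p) with σ e (count n) ≤? n
    ... | yes q = s≤s (≮⇒≥ λ k<x → <-irrefl refl (count-complete n (<-≤-trans (σ-mono-< k<x) p)))
    ... | no ¬q = ≰⇒> λ k≤x → ¬q (≤-trans (σ-mono k≤x) p)

    count-suc-≤ : ∀ n → count (suc n) ≤ suc (count n)
    count-suc-≤ n with σ e (count n) ≤? n
    ... | yes _ = ≤-refl
    ... | no  _ = n≤1+n _

    count≤ : ∀ n → count n ≤ n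
    count≤ n = below⇒≤ λ y p → ≤-<-trans (x≤σ y) (count-sound n p)

    count-pos : ∀ n → 0 < count (suc n)
    count-pos n = count-complete (suc n) z<s

    count-lower : ∀ {v f} → v ≤ σ e f → count v ≤ f
    count-lower {v} {f} p = ≮⇒≥ λ f<k → <⇒≱ (count-sound v f<k) p

    count-gap : ∀ n → n ≤ σ e (count n)
    count-gap n = ≮⇒≥ λ p → <-irrefl refl (count-complete n p)

    count-σ : ∀ x → count (σ e x) ≡ x
    count-σ x = ≤-antisym (count-lower ≤-refl) (≮⇒≥ λ k<x → <-irrefl refl (count-complete _ (σ-mono-< k<x)))

    -- `n ∸ count n` counts the numbers below `n` that are not values of `σ e`; it never falls
    -- because `count` grows by at most 1 per step.
    excess-mono : ∀ {m n} → m ≤ n → m ∸ count m ≤ n ∸ count n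
    excess-mono p = go (≤⇒≤′ p)
      where
      go : ∀ {m n} → m ≤′ n → m ∸ count m ≤ n ∸ count n
      go (≤′-reflexive refl) = ≤-refl
      go (≤′-step {n} p)     = ≤-trans (go p) (∸-monoʳ-≤ (suc n) (count-suc-≤ n))

    -- `count` inverts `σ e`, so the subtraction removes exactly the index `suc y + suc y` from the
    -- recursion for `σ e`.
    excess-σ-even : ∀ y → σ e (suc y + suc y) ∸ count (σ e (suc y + suc y)) ≡ e + σ e (suc y)
    excess-σ-even y rewrite count-σ (suc y + suc y) | σ-even y =
      trans (cong (_∸ (suc y + suc y)) (shuffle e (suc y + suc y) (σ e (suc y)))) (m+n∸n≡m _ (suc y + suc y))
      where
      shuffle : ∀ a b c → a + b + c ≡ a + c + b
      shuffle = solve-∀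

    -- σ grows by at least 2 from 2y + 1 to 2y + 2, so both σ (2y + 2) and its
    -- predecessor have count 2y + 2.
    excess-below-σ-even : ∀ y {m} → m < σ e (suc y + suc y) → m ∸ count m < e + σ e (suc y)
    excess-below-σ-even y {m} m<s with σ e (suc y + suc y) in eq
    ... | suc s = begin-strict
      m ∸ count m                     ≤⟨ excess-mono (≤-pred m<s) ⟩
      s ∸ count s                     ≤⟨ ∸-monoʳ-≤ s count-s ⟩
      s ∸ (suc y + suc y)             <⟨ ≤-reflexive (sym (+-∸-assoc 1 2y≤s)) ⟩
      suc s ∸ (suc y + suc y)         ≡⟨ cong₂ _∸_ (sym eq) (sym (count-σ (suc y + suc y))) ⟩
      σ e (suc y + suc y) ∸ count (σ e (suc y + suc y)) ≡⟨ excess-σ-even y ⟩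
      e + σ e (suc y)                 ∎
      where
      open ≤-Reasoning
      gap : suc (σ e (suc (y + y))) < σ e (suc y + suc y)
      gap rewrite σ-even y | σ-odd y | +-suc y y | +-suc e (suc (y + y)) =
        s≤s (+-monoʳ-< (e + suc (y + y)) (σ-mono-< (n<1+n y)))
      count-s : suc y + suc y ≤ count s
      count-s = subst (λ z → suc z ≤ count s) (sym (+-suc y y))
                  (count-complete s (≤-pred (subst (suc (σ e (suc (y + y))) <_) eq gap)))
      2y≤s : suc y + suc y ≤ s
      2y≤s = ≤-trans count-s (count≤ s)

    -- With its converse `σ-even≤⇐`, this is the source of the nested arguments: the index `y + y`
    -- is counted for `m` exactly when `y` is counted for the excess of `m`, shifted by `e`. For `y`
    -- = 0 the value `σ e 0` lacks the summand `e`, and the hypothesis on `e` supplies the bound.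
    σ-even≤⇒ : ∀ y {m} → e ≤ m ∸ count m → σ e (y + y) ≤ m → e + σ e y ≤ m ∸ count m
    σ-even≤⇒ zero    {m} h p = subst (_≤ m ∸ count m) (sym (+-identityʳ e)) h
    σ-even≤⇒ (suc y) {m} h p = subst (_≤ m ∸ count m) (excess-σ-even y) (excess-mono p)

    σ-even≤⇐ : ∀ y {m} → e + σ e y ≤ m ∸ count m → σ e (y + y) ≤ m
    σ-even≤⇐ zero    p = z≤n
    σ-even≤⇐ (suc y) p = ≮⇒≥ λ q → <⇒≱ (excess-below-σ-even y q) p

    count-half : ∀ m → e ≤ m ∸ count m → count (suc (m ∸ count m) ∸ e) ≡ ⌈ count (suc m) /2⌉
    count-half m h = ≤-antisym (below⇒≤ to) (below⇒≤ from)
      where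
      k = m ∸ count m
      to : ∀ y → y < count (suc k ∸ e) → y < ⌈ count (suc m) /2⌉
      to y p = ⌊/2⌋-below y _ (s≤s (count-complete (suc m) (s≤s (σ-even≤⇐ y
        (≤-pred (subst (suc (e + σ e y) ≤_) (m+[n∸m]≡n (m≤n⇒m≤1+n h))
          (subst (_≤ e + (suc k ∸ e)) (+-suc e (σ e y)) (+-monoʳ-≤ e (count-sound _ p)))))))))
      from : ∀ y → y < ⌈ count (suc m) /2⌉ → y < count (suc k ∸ e)
      from y p = count-complete (suc k ∸ e)
        (m+n≤o⇒m≤o∸n (suc (σ e y)) (subst (_≤ suc k) (cong suc (+-comm e (σ e y)))
          (s≤s (σ-even≤⇒ y h (≤-pred (count-sound (suc m) (≤-pred (below-⌊/2⌋ y _ p))))))))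

    σ-odd≡suc-even : ∀ y → σ e (suc (suc y + suc y)) ≡ suc (σ e (suc y + suc y))
    σ-odd≡suc-even y rewrite σ-odd (suc y) | σ-even y | +-suc e (suc y + suc y) = refl

    -- Pairs the even index `y + y` at `n` with the odd index one higher at `suc n`. For positive
    -- `y` the two values differ by 1; for `y` = 0 they are 0 and `e + 1`, and `e < n` makes both
    -- count.
    ⌈count/2⌉ : ∀ n → e < n → ⌈ count n /2⌉ ≡ ⌊ count (suc n) /2⌋
    ⌈count/2⌉ n e<n = ≤-antisym (below⇒≤ to) (below⇒≤ from)
      where
      up : ∀ y → σ e (y + y) < n → σ e (suc (y + y)) < suc n
      up zero    _ rewrite +-comm e 1 | +-identityʳ e = s≤s e<n
      up (suc y) p rewrite σ-odd≡suc-even y = s≤s p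
      down : ∀ y → σ e (suc (y + y)) < suc n → σ e (y + y) < n
      down zero    _ = ≤-<-trans z≤n e<n
      down (suc y) p rewrite σ-odd≡suc-even y = ≤-pred p
      to : ∀ y → y < ⌈ count n /2⌉ → y < ⌊ count (suc n) /2⌋
      to y p = ⌊/2⌋-below y _ (count-complete (suc n) (up y (count-sound n (≤-pred (below-⌊/2⌋ y _ p)))))
      from : ∀ y → y < ⌊ count (suc n) /2⌋ → y < ⌈ count n /2⌉
      from y p = ⌊/2⌋-below y _ (s≤s (count-complete n (down y (count-sound (suc n) (below-⌊/2⌋ y _ p)))))

    -- The count is split by parity: `count-half` at `suc k` gives the even indices, and `⌈count/2⌉`
    -- reduces the odd ones to `count-half` at `k`. For `e` = 0 this is the Conolly recursion, for
    -- `e` = 1 the Tanny recursion.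
    count-rec : ∀ k → e ≤ k → e ≤ k ∸ count k →
                count (suc (suc k)) ≡
                count (suc (suc k ∸ count (suc k)) ∸ e) + count (suc (k ∸ count k) ∸ e)
    count-rec k e≤k h = begin
      count (suc (suc k))                                        ≡⟨ sym (⌊n/2⌋+⌈n/2⌉≡n _) ⟩
      ⌊ count (suc (suc k)) /2⌋ + ⌈ count (suc (suc k)) /2⌉       ≡⟨ +-comm ⌊ count (suc (suc k)) /2⌋ _ ⟩
      ⌈ count (suc (suc k)) /2⌉ + ⌊ count (suc (suc k)) /2⌋
        ≡⟨ cong₂ _+_ (sym (count-half (suc k) (≤-trans h (excess-mono (n≤1+n k)))))
                     (trans (sym (⌈count/2⌉ (suc k) (s≤s e≤k))) (sym (count-half k h))) ⟩
      count (suc (suc k ∸ count (suc k)) ∸ e) + count (suc (k ∸ count k) ∸ e) ∎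
      where open ≡-Reasoning

  -- The Conolly and Tanny sequences as counting functions.

  ∸-count<suc : ∀ e m → suc m ∸ count e (suc m) < suc m
  ∸-count<suc e m = ∸-monoʳ-< (count-pos e m) (count≤ e (suc m))

  conolly≡count : ∀ f n → n < f → conolly f n ≡ count 0 n
  conolly≡count (suc f) 0 _ = refl
  conolly≡count (suc f) 1 _ = refl
  conolly≡count (suc f) 2 _ = refl
  conolly≡count (suc f) (suc (suc (suc k))) (s≤s p) =
    trans (cong₂ _+_ (term (suc k) p) (term k (≤-trans (n≤1+n _) p)))
          (sym (count-rec 0 (suc k) z≤n z≤n))
    where
    term : ∀ m → suc m < f →
           conolly f (suc (suc m) ∸ conolly f (suc m)) ≡ count 0 (suc (suc m ∸ count 0 (suc m)))
    term m q rewrite conolly≡count f (suc m) q =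
      trans (cong (conolly f) (+-∸-assoc 1 (count≤ 0 (suc m))))
            (conolly≡count f _ (≤-trans (s≤s (∸-count<suc 0 m)) q))

  C≡count : ∀ n → C n ≡ count 0 n
  C≡count n = conolly≡count (suc n) n ≤-refl

  -- Arguments are successors because `T 0` is 1 while `count 1 0` is 0.
  tanny≡count : ∀ f n → suc n < f → tanny f (suc n) ≡ count 1 (suc n)
  tanny≡count (suc f) 0 _ = refl
  tanny≡count (suc f) 1 _ = refl
  -- The argument 3 is evaluated directly: `count-rec` at `k` = 1 would need a positive excess at 1,
  -- where the excess is 0.
  tanny≡count 2 2 (s≤s (s≤s ()))
  tanny≡count 3 2 (s≤s (s≤s (s≤s ())))
  tanny≡count (suc (suc (suc (suc f)))) 2 _ = refl
  tanny≡count (suc f) (suc (suc (suc k))) (s≤s p) =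
    trans (cong₂ _+_ (term (suc (suc k)) (s≤s z≤n) p) (term (suc k) (s≤s z≤n) (≤-trans (n≤1+n _) p)))
          (sym (count-rec 1 (suc (suc k)) (s≤s z≤n) (excess-pos (suc k) (s≤s z≤n))))
    where
    -- The excess is already 1 at 2 and never falls, so the nested arguments stay clear of the
    -- exceptional argument 0.
    excess-pos : ∀ m → 1 ≤ m → 1 ≤ suc m ∸ count 1 (suc m)
    excess-pos m 1≤m = excess-mono 1 (s≤s 1≤m)
    term : ∀ m → 1 ≤ m → suc m < f →
           tanny f (suc m ∸ tanny f (suc m)) ≡ count 1 (suc m ∸ count 1 (suc m))
    term m 1≤m q rewrite tanny≡count f m q
      with suc m ∸ count 1 (suc m) | excess-pos m 1≤m | ∸-count<suc 1 m
    ... | suc r | _ | r<m = tanny≡count f r (≤-trans r<m (≤-trans (n≤1+n _) q))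

  T≡count : ∀ n → T (suc n) ≡ count 1 (suc n)
  T≡count n = tanny≡count (suc (suc n)) n ≤-refl

  -- Bounds on `σ` and closed forms for the three minima.

  double : ∀ n → n + n ≡ 2 * n
  double = solve-∀

  -- Adds a level of `m` vertices below one of `f`: the hypothesis gives `f ≤ ⌊ m /2⌋`, and `σ 0 m`
  -- is `m + σ 0 ⌊ m /2⌋`.
  σ₀-step : ∀ m {f} → f + f ≤ m → m + σ 0 f ≤ σ 0 m
  σ₀-step zero    {zero} _ = z≤n
  σ₀-step (suc m) {f}    p rewrite σ-suc 0 m =
    +-monoʳ-≤ (suc m) (σ-mono 0 (≤-trans (≤-reflexive (n≡⌊n+n/2⌋ f)) (⌊n/2⌋-mono p)))

  -- A geometric series. Strictness is what forces a nonempty union of full subtrees to have a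
  -- component of its own in `split⇒T`.
  σ₀-upper : ∀ x → 0 < x → σ 0 x < x + x
  σ₀-upper = halving-rec (λ x → 0 < x → σ 0 x < x + x) (λ ()) step
    where
    step : ∀ x → (0 < ⌊ suc x /2⌋ → σ 0 ⌊ suc x /2⌋ < ⌊ suc x /2⌋ + ⌊ suc x /2⌋) →
           0 < suc x → σ 0 (suc x) < suc x + suc x
    step zero    ih _ = ≤-refl
    step (suc x) ih _ rewrite σ-suc 0 (suc x) =
      +-monoʳ-< (suc (suc x)) (<-≤-trans (ih z<s) (⌊/2⌋-double (suc (suc x))))

  σ₀-upper-≤ : ∀ x → σ 0 x ≤ x + x
  σ₀-upper-≤ zero    = z≤n
  σ₀-upper-≤ (suc x) = <⇒≤ (σ₀-upper (suc x) z<s)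

  -- The extra 1 in every summand pays for rounding the halves down.
  σ₁-lower : ∀ x → x + x ≤ σ 1 x
  σ₁-lower = halving-rec (λ x → x + x ≤ σ 1 x) z≤n step
    where
    ⌈/2⌉≤ : ∀ n → ⌈ n /2⌉ ≤ suc ⌊ n /2⌋
    ⌈/2⌉≤ 0 = z≤n
    ⌈/2⌉≤ 1 = ≤-refl
    ⌈/2⌉≤ (suc (suc n)) = s≤s (⌈/2⌉≤ n)
    step : ∀ x → ⌊ suc x /2⌋ + ⌊ suc x /2⌋ ≤ σ 1 ⌊ suc x /2⌋ → suc x + suc x ≤ σ 1 (suc x)
    step x ih rewrite σ-suc 1 x = begin
      suc x + suc x                           ≡⟨ cong (suc x +_) (sym (⌊n/2⌋+⌈n/2⌉≡n (suc x))) ⟩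
      suc x + (h + ⌈ suc x /2⌉)               ≤⟨ +-monoʳ-≤ (suc x) (+-monoʳ-≤ h (⌈/2⌉≤ (suc x))) ⟩
      suc x + (h + suc h)                     ≡⟨ shuffle x h ⟩
      suc (suc x) + (h + h)                   ≤⟨ +-monoʳ-≤ (suc (suc x)) ih ⟩
      suc (suc x) + σ 1 h                     ∎
      where
      open ≤-Reasoning
      h = ⌊ suc x /2⌋
      shuffle : ∀ x h → suc x + (h + suc h) ≡ suc (suc x) + (h + h)
      shuffle = solve-∀

  T-pos : ∀ n → 0 < T n
  T-pos zero    = z<s
  T-pos (suc n) = subst (0 <_) (sym (T≡count n)) (count-pos 1 n)

  T-complete : ∀ {x n} → σ 1 x < n → x < T n
  T-complete {x} {suc n} p = subst (x <_) (sym (T≡count n)) (count-complete 1 (suc n) p)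

  T-pred : ∀ n → ∃ λ x → T (suc n) ≡ suc x × σ 1 x ≤ n
  T-pred n with T (suc n) | T≡count n | T-pos (suc n)
  ... | suc x | eq | _ = x , refl , ≤-pred (count-sound 1 (suc n) (≤-reflexive eq))

  C-lower : ∀ {v f} → v ≤ σ 0 f → C v ≤ f
  C-lower {v} p = subst (_≤ _) (sym (C≡count v)) (count-lower 0 p)

  C-gap : ∀ v → v ≤ σ 0 (C v)
  C-gap v = subst (λ k → v ≤ σ 0 k) (sym (C≡count v)) (count-gap 0 v)

  -- These turn out to be the three minima. `δP′-eq` and `δC′-eq` show that the subtractions are
  -- exact; both closed forms vanish at 0, as the convention demands.
  δP′ δC′ δ′ : ℕ → ℕ
  cost : ℕ → ℕ → ℕ
  δP′ n = 2 * C n ∸ n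
  δC′ n = n + 2 ∸ 2 * T n
  cost n v = δP′ v + δC′ (n ∸ v)
  δ′ n = min≤ n (cost n)

  δP′-eq : ∀ n → δP′ n + n ≡ 2 * C n
  δP′-eq n = m∸n+n≡m (≤-trans (C-gap n) (≤-trans (σ₀-upper-≤ (C n)) (≤-reflexive (double (C n)))))

  δC′-eq : ∀ n → δC′ n + 2 * T n ≡ n + 2
  δC′-eq zero    = refl
  δC′-eq (suc n) with T (suc n) | T-pred n
  ... | _ | x , refl , p = m∸n+n≡m (begin
    2 * suc x       ≡⟨ shuffle x ⟩
    (x + x) + 2     ≤⟨ +-monoˡ-≤ 2 (≤-trans (σ₁-lower x) (≤-trans p (n≤1+n n))) ⟩
    suc n + 2       ∎)
    where
    open ≤-Reasoning
    shuffle : ∀ x → 2 * suc x ≡ (x + x) + 2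
    shuffle = solve-∀

  δC′≤ : ∀ n → δC′ n ≤ n
  δC′≤ n = +-cancelʳ-≤ 2 _ _ (begin
    δC′ n + 2          ≤⟨ +-monoʳ-≤ (δC′ n) (*-monoʳ-≤ 2 (T-pos n)) ⟩
    δC′ n + 2 * T n    ≡⟨ δC′-eq n ⟩
    n + 2              ∎)
    where open ≤-Reasoning

  -- Splitting into a connected set and full subtrees.

  -- A set with a leaves, K components and n vertices is dominated by one connected
  -- set with 1 + w leaves and a union of full subtrees with f leaves, v vertices
  -- and 2f − v components.
  record Split (a K n : ℕ) : Set where
    constructor split
    field
      w f v       : ℕ
      leaves      : a ≡ suc w + f
      full        : v ≤ σ 0 f
      components  : f + f + 1 ≤ K + v
      size        : suc (σ 1 w) + v ≤ n

  -- When only parentless leaves are used, one of them is the connected part and the other `a` are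
  -- full subtrees with a single vertex.
  split-singletons : ∀ {a c b K n} → a < c → Split (suc a) (c + K) (b + c + n)
  split-singletons {a} {c} {b} {K} {n} a<c = split 0 a a refl (x≤σ 0 a)
    (≤-trans (≤-reflexive (shuffle a)) (+-monoˡ-≤ a (≤-trans a<c (m≤m+n c K))))
    (≤-trans a<c (≤-trans (m≤n+m c b) (m≤m+n (b + c) n)))
    where
    shuffle : ∀ a → a + a + 1 ≡ suc a + a
    shuffle = solve-∀

  -- One level down, the leaves of both parts are doubled and the `c′` parentless vertices join the
  -- full part as one-vertex subtrees. The new leaves of each part are also its new vertices, which
  -- the recursion for `σ` accounts for.
  split-down : ∀ {h K n b c b′ c′} → b′ ≡ h + h ⊎ suc b′ ≡ h + h → b′ ≤ b → c′ ≤ c →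
               Split h K n → Split (b′ + c′) (c + K) (b + c + n)
  split-down {h} {K} {n} {b} {c} {b′} {c′} parity p q (split w f v refl fu co si) = go parity
    where
    open ≤-Reasoning
    f₁ = f + f + c′
    v₁ = f₁ + v

    full₁ : v₁ ≤ σ 0 f₁
    full₁ = ≤-trans (+-monoʳ-≤ f₁ fu) (σ₀-step f₁ {f} (m≤m+n (f + f) c′))

    components₁ : f₁ + f₁ + 1 ≤ c + K + v₁
    components₁ = begin
      f₁ + f₁ + 1               ≡⟨ eq₁ f c′ ⟩
      f₁ + c′ + (f + f + 1)     ≤⟨ +-mono-≤ (+-monoʳ-≤ f₁ q) co ⟩
      f₁ + c + (K + v)          ≡⟨ eq₂ f₁ c K v ⟩
      c + K + (f₁ + v)          ∎
      where
      eq₁ : ∀ f c → f + f + c + (f + f + c) + 1 ≡ f + f + c + c + (f + f + 1)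
      eq₁ = solve-∀
      eq₂ : ∀ f c K v → f + c + (K + v) ≡ c + K + (f + v)
      eq₂ = solve-∀

    size₁ : ∀ {w₁ s} → σ 1 w₁ ≤ s → suc s + v₁ ≡ b′ + c′ + (suc (σ 1 w) + v) →
            suc (σ 1 w₁) + v₁ ≤ b + c + n
    size₁ {w₁} {s} r eq = begin
      suc (σ 1 w₁) + v₁                ≤⟨ +-monoˡ-≤ v₁ (s≤s r) ⟩
      suc s + v₁                       ≡⟨ eq ⟩
      b′ + c′ + (suc (σ 1 w) + v)      ≤⟨ +-mono-≤ (+-mono-≤ p q) si ⟩
      b + c + n                        ∎

    odd-sum : ∀ w f → w + f + (suc w + f) ≡ suc (w + w) + (f + f)
    odd-sum = solve-∀

    go : b′ ≡ (suc w + f) + (suc w + f) ⊎ suc b′ ≡ (suc w + f) + (suc w + f) →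
         Split (b′ + c′) (c + K) (b + c + n)
    go (inj₁ refl) = split (suc (w + w)) f₁ v₁ (eq₁ w f c′) full₁ components₁
      (size₁ {suc (w + w)} (≤-reflexive (σ-odd 1 w)) (eq₂ w f c′ v (σ 1 w)))
      where
      eq₁ : ∀ w f c → suc w + f + (suc w + f) + c ≡ suc (suc (w + w)) + (f + f + c)
      eq₁ = solve-∀
      eq₂ : ∀ w f c v t → suc (1 + suc (w + w) + t) + (f + f + c + v) ≡
                          suc w + f + (suc w + f) + c + (suc t + v)
      eq₂ = solve-∀
    -- Odd case: the connected part gives up one of its doubled leaves, keeping `suc (w + w)`. For
    -- `w` = 0 this makes the size estimate a strict inequality, whence `σ-even-≤`.
    go (inj₂ e) with refl ← trans (suc-injective e) (odd-sum w f) = split (w + w) f₁ v₁ (eq₁ w f c′) full₁ components₁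
      (size₁ {w + w} (σ-even-≤ 1 w) (eq₂ w f c′ v (σ 1 w)))
      where
      eq₁ : ∀ w f c → suc (w + w) + (f + f) + c ≡ suc (w + w) + (f + f + c)
      eq₁ = solve-∀
      eq₂ : ∀ w f c v t → suc (1 + (w + w) + t) + (f + f + c + v) ≡
                          suc (w + w) + (f + f) + c + (suc t + v)
      eq₂ = solve-∀

  halve-up : ∀ b → b ≡ ⌈ b /2⌉ + ⌈ b /2⌉ ⊎ suc b ≡ ⌈ b /2⌉ + ⌈ b /2⌉
  halve-up 0 = inj₁ refl
  halve-up 1 = inj₂ refl
  halve-up (suc (suc b)) rewrite +-suc ⌈ b /2⌉ ⌈ b /2⌉ with halve-up b
  ... | inj₁ e = inj₁ (cong (λ k → suc (suc k)) e)
  ... | inj₂ e = inj₂ (cong (λ k → suc (suc k)) e)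

  -- All smaller positive leaf counts are included because the descent calls on the level above at
  -- half the chosen number of attached vertices, which can be less than that level holds.
  Splits : ℕ → ℕ → ℕ → Set
  Splits a K n = ∀ a′ → 0 < a′ → a′ ≤ a → Split a′ K n

  -- The `a′` leaves are taken from the `b` attached vertices first, and from the `c` parentless
  -- ones only once those are used up.
  splits-down : ∀ {a K n} b c → b ≤ a + a → Splits a K n → Splits (b + c) (c + K) (b + c + n)
  splits-down {a} {K} {n} b c b≤2a ih a′ 0<a′ a′≤ = go (≤-total a′ b)
    where
    part : ∀ b′ c′ → 0 < b′ + c′ → b′ ≤ b → c′ ≤ c → Split (b′ + c′) (c + K) (b + c + n)
    part zero     (suc c′) _ _ q = split-singletons {b = b} q
    part (suc b′) c′ _ p q = split-down (halve-up (suc b′)) p q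
      (ih ⌈ suc b′ /2⌉ z<s
        (≤-trans (⌈n/2⌉-mono (≤-trans p b≤2a)) (≤-reflexive (sym (n≡⌈n+n/2⌉ a)))))
    go : a′ ≤ b ⊎ b ≤ a′ → Split a′ (c + K) (b + c + n)
    go (inj₁ a′≤b) = subst (λ k → Split k _ _) (+-identityʳ a′)
      (part a′ 0 (subst (0 <_) (sym (+-identityʳ a′)) 0<a′) a′≤b z≤n)
    go (inj₂ b≤a′) = subst (λ k → Split k _ _) (m+[n∸m]≡n b≤a′)
      (part b (a′ ∸ b) (subst (0 <_) (sym (m+[n∸m]≡n b≤a′)) 0<a′) ≤-refl
        (≤-trans (∸-monoˡ-≤ b a′≤) (≤-reflexive (m+n∸m≡n b c))))

  -- The full part forces `C v ≤ f`, and the connected part, having at most `n ∸ v` vertices, forces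
  -- `w < T (n ∸ v)`. Inserted into the closed forms, these turn `components` into the bound on the
  -- cost.
  split⇒δ : ∀ {a K n} → Split a K n → ∃ λ v → v ≤ n × cost n v + 2 * a ≤ n + 2 * K
  split⇒δ {a} {K} {n} (split w f v refl fu co si) =
    v , v≤n , +-cancelʳ-≤ v _ _ (begin
      δP′ v + δC′ m + 2 * (suc w + f) + v       ≡⟨ eq₁ (δP′ v) (δC′ m) w f v ⟩
      (δP′ v + v) + (δC′ m + 2 * suc w) + 2 * f ≤⟨ +-monoˡ-≤ (2 * f) (+-monoʳ-≤ (δP′ v + v) (+-monoʳ-≤ (δC′ m) (*-monoʳ-≤ 2 w<T))) ⟩
      (δP′ v + v) + (δC′ m + 2 * T m) + 2 * f   ≡⟨ cong₂ (λ x y → x + y + 2 * f) (δP′-eq v) (δC′-eq m) ⟩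
      2 * C v + (m + 2) + 2 * f                 ≤⟨ +-monoˡ-≤ (2 * f) (+-monoˡ-≤ (m + 2) (*-monoʳ-≤ 2 (C-lower {v} {f} fu))) ⟩
      2 * f + (m + 2) + 2 * f                   ≡⟨ eq₂ f m ⟩
      2 * (f + f + 1) + m                       ≤⟨ +-monoˡ-≤ m (*-monoʳ-≤ 2 co) ⟩
      2 * (K + v) + m                           ≡⟨ eq₃ K v m ⟩
      (m + v) + 2 * K + v                       ≡⟨ cong (λ k → k + 2 * K + v) (m∸n+n≡m v≤n) ⟩
      n + 2 * K + v                             ∎)
    where
    open ≤-Reasoning
    m = n ∸ v
    v≤n : v ≤ n
    v≤n = ≤-trans (m≤n+m v (suc (σ 1 w))) si
    w<T : w < T m
    w<T = T-complete (m+n≤o⇒m≤o∸n (suc (σ 1 w)) si)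
    eq₁ : ∀ p c w f v → p + c + 2 * (suc w + f) + v ≡ (p + v) + (c + 2 * suc w) + 2 * f
    eq₁ = solve-∀
    eq₂ : ∀ f m → 2 * f + (m + 2) + 2 * f ≡ 2 * (f + f + 1) + m
    eq₂ = solve-∀
    eq₃ : ∀ K v m → 2 * (K + v) + m ≡ (m + v) + 2 * K + v
    eq₃ = solve-∀

  -- With at most one component the full part is empty: otherwise `v` is below `f + f`, against
  -- `components`. For `f` = 0 also `v` = 0, and `components` reads `1 ≤ K`.
  split⇒T : ∀ {a K n} → K ≤ 1 → Split a K n → 1 ≤ K × a ≤ T n
  split⇒T {K = K} K≤1 (split w zero v refl fu co si) with n≤0⇒n≡0 fu
  ... | refl rewrite +-identityʳ w | +-identityʳ K =
    co , T-complete (≤-trans (m≤m+n _ 0) si)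
  split⇒T {K = K} K≤1 (split w (suc f) v refl fu co si) =
    contradiction co (<⇒≱ (begin-strict
      K + v                   ≤⟨ +-mono-≤ K≤1 fu ⟩
      1 + σ 0 (suc f)         <⟨ s≤s (σ₀-upper (suc f) z<s) ⟩
      1 + (suc f + suc f)     ≡⟨ +-comm 1 _ ⟩
      suc f + suc f + 1       ∎))
    where open ≤-Reasoning

open Sequences

-- Finite vertex sets, their levels and their children.

module Cuts where

  open import Data.Nat.Base using (_+_; _*_)
  open import Data.Product.Base using (_×_)

  module _ {a} {A : Set a} where

    unique-⊆⇒length≤ : ∀ {xs ys : List A} → Unique xs → (∀ {x} → x ∈ xs → x ∈ ys) → length xs ≤ length ys
    unique-⊆⇒length≤ {[]}     {ys} _        _ = z≤n
    unique-⊆⇒length≤ {x ∷ xs} {ys} (x∉ ∷ u) f with ∈-∃++ (f (here refl))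
    ... | as , bs , refl = begin
      suc (length xs)              ≤⟨ s≤s (unique-⊆⇒length≤ u g) ⟩
      suc (length (as ++ bs))      ≡⟨ cong suc (length-++ as) ⟩
      suc (length as + length bs)  ≡⟨ sym (+-suc (length as) (length bs)) ⟩
      length as + suc (length bs)  ≡⟨ sym (length-++ as) ⟩
      length (as ++ x ∷ bs)        ∎
      where
      open ≤-Reasoning
      g : ∀ {y} → y ∈ xs → y ∈ as ++ bs
      g y∈ with ∈-++⁻ as (f (there y∈))
      ... | inj₁ p         = ∈-++⁺ˡ p
      ... | inj₂ (here eq) = contradiction (sym eq) (All.lookup x∉ y∈)
      ... | inj₂ (there p) = ∈-++⁺ʳ as p

    length-filter-¬ : ∀ {p} {P : Pred A p} (P? : Decidable P) xs →
                      length (filter P? xs) + length (filter (¬? ∘ P?) xs) ≡ length xs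
    length-filter-¬ P? []       = refl
    length-filter-¬ P? (x ∷ xs) with P? x
    ... | yes _ = cong suc (length-filter-¬ P? xs)
    ... | no  _ = trans (+-suc _ _) (cong suc (length-filter-¬ P? xs))

    length-filter-filter-¬ : ∀ {p q} {P : Pred A p} {Q : Pred A q} (P? : Decidable P) (Q? : Decidable Q) xs →
      length (filter Q? (filter P? xs)) + length (filter Q? (filter (¬? ∘ P?) xs)) ≡ length (filter Q? xs)
    length-filter-filter-¬ P? Q? []       = refl
    length-filter-filter-¬ P? Q? (x ∷ xs) with P? x
    ... | yes _ with Q? x
    ...   | yes _ = cong suc (length-filter-filter-¬ P? Q? xs)
    ...   | no  _ = length-filter-filter-¬ P? Q? xs
    length-filter-filter-¬ P? Q? (x ∷ xs) | no _ with Q? x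
    ...   | yes _ = trans (+-suc _ _) (cong suc (length-filter-filter-¬ P? Q? xs))
    ...   | no  _ = length-filter-filter-¬ P? Q? xs

  level : Vertex → ℕ
  level = proj₁

  atLevel : ℕ → List Vertex → List Vertex
  atLevel i = filter (λ x → level x ≟ i)

  fromLevel : ℕ → List Vertex → List Vertex
  fromLevel i = filter (λ x → i ≤? level x)

  length-fromLevel : ∀ i S → length (fromLevel i S) ≡ length (atLevel i S) + length (fromLevel (suc i) S)
  length-fromLevel i []      = refl
  length-fromLevel i (x ∷ S) with <-cmp (level x) i
  ... | tri< l ¬e _
    rewrite filter-reject (λ x → i ≤? level x) {x = x} {xs = S} (<⇒≱ l)
          | filter-reject (λ x → level x ≟ i) {x = x} {xs = S} ¬e
          | filter-reject (λ x → suc i ≤? level x) {x = x} {xs = S} (<⇒≯ l) = length-fromLevel i S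
  ... | tri≈ _ refl _
    rewrite filter-accept (λ x → i ≤? level x) {x = x} {xs = S} ≤-refl
          | filter-accept (λ x → level x ≟ i) {x = x} {xs = S} refl
          | filter-reject (λ x → suc i ≤? level x) {x = x} {xs = S} (<-irrefl refl) = cong suc (length-fromLevel i S)
  ... | tri> _ ¬e g
    rewrite filter-accept (λ x → i ≤? level x) {x = x} {xs = S} (<⇒≤ g)
          | filter-reject (λ x → level x ≟ i) {x = x} {xs = S} ¬e
          | filter-accept (λ x → suc i ≤? level x) {x = x} {xs = S} g =
    trans (cong suc (length-fromLevel i S)) (sym (+-suc _ _))

  fromLevel-0 : ∀ S → fromLevel 0 S ≡ S
  fromLevel-0 []      = refl
  fromLevel-0 (x ∷ S) = cong (x ∷_) (fromLevel-0 S)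

  levels-bounded : ∀ (S : List Vertex) → ∃ λ H → ∀ {x} → x ∈ S → level x < H
  levels-bounded []      = 0 , λ ()
  levels-bounded (x ∷ S) with levels-bounded S
  ... | H , p = suc (level x) ⊔ H , λ
    { (here refl) → m≤m⊔n _ H
    ; (there q)   → ≤-trans (p q) (m≤n⊔m _ H) }

  ∈-children⇒ : ∀ {x y} → y ∈ children x → parent y ≡ x
  ∈-children⇒ {x} {y} = Equivalence.to (∈-children⇔ x y)

  ∈-children-parent : ∀ y → y ∈ children (parent y)
  ∈-children-parent y = Equivalence.from (∈-children⇔ (parent y) y) refl

  allChildren : List Vertex → List Vertex
  allChildren = concatMap children

  ∈-allChildren⁺ : ∀ {S y} → parent y ∈ S → y ∈ allChildren S
  ∈-allChildren⁺ {y = y} p = ∈-concatMap⁺ children (Any.map (λ { refl → ∈-children-parent y }) p)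

  ∈-allChildren⁻ : ∀ {S y} → y ∈ allChildren S → parent y ∈ S
  ∈-allChildren⁻ p = Any.map ∈-children⇒ (∈-concatMap⁻ children p)

  children-unique : ∀ x → Unique (children x)
  children-unique (zero  , j) = []
  children-unique (suc i , j) = ((λ eq → 1+n≢n (sym (cong proj₂ eq))) ∷ []) ∷ [] ∷ []

  allChildren-unique : ∀ {S} → Unique S → Unique (allChildren S)
  allChildren-unique []               = []
  allChildren-unique {x ∷ S} (x∉ ∷ u) = Unique.++⁺ (children-unique x) (allChildren-unique u)
    λ (p , q) → contradiction (sym (∈-children⇒ p)) λ eq → All.lookup x∉ (∈-allChildren⁻ q) eq

  length-allChildren : ∀ S → length (allChildren S) + 2 * length (atLevel 0 S) ≡ 2 * length S
  length-allChildren []                = refl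
  length-allChildren ((zero  , j) ∷ S) = trans (eq (length (allChildren S)) (length (atLevel 0 S)))
                                           (trans (cong (2 +_) (length-allChildren S)) (sym (*-suc 2 (length S))))
    where
    eq : ∀ a b → a + 2 * suc b ≡ 2 + (a + 2 * b)
    eq = solve-∀
  length-allChildren ((suc i , j) ∷ S) = trans (cong (2 +_) (length-allChildren S)) (sym (*-suc 2 (length S)))

  length-allChildren-atLevel : ∀ i S → length (allChildren (atLevel (suc i) S)) ≡ 2 * length (atLevel (suc i) S)
  length-allChildren-atLevel i []      = refl
  length-allChildren-atLevel i (x ∷ S) with level x ≟ suc i
  ... | yes refl rewrite filter-accept (λ x → level x ≟ suc i) {x = x} {xs = S} refl =
    trans (cong (2 +_) (length-allChildren-atLevel i S)) (sym (*-suc 2 (length (atLevel (suc i) S))))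
  ... | no ≢ rewrite filter-reject (λ x → level x ≟ suc i) {x = x} {xs = S} ≢ = length-allChildren-atLevel i S

  -- The cut formula and the counts of vertices by level.

  module _ (S : List Vertex) where

    attached tops : List Vertex
    attached = filter (λ x → parent x ∈? S) S
    tops     = filter (λ x → ¬? (parent x ∈? S)) S

    leaves# tops# : ℕ
    leaves# = length (atLevel 0 S)
    tops#   = length tops

    attached+tops : length attached + tops# ≡ length S
    attached+tops = length-filter-¬ (λ x → parent x ∈? S) S

    outside : List Vertex → List Vertex
    outside = filter (λ y → ¬? (y ∈? S))

    -- `boundary S` is `cut S`; the separate argument lets an induction shorten the list while
    -- membership is still tested in `S`.
    boundary : List Vertex → List (Vertex × Vertex)
    boundary = concatMap (λ x → map (x ,_) (outside (neighbours x)))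

    length-boundary : ∀ x R → length (boundary (x ∷ R)) ≡ length (outside (neighbours x)) + length (boundary R)
    length-boundary x R = trans (length-++ (map (x ,_) (outside (neighbours x))))
                                (cong (_+ length (boundary R)) (length-map (x ,_) (outside (neighbours x))))

    inside-or-outside : ∀ xs ys → length (filter (_∈? S) (xs ++ ys)) + length (outside xs) ≡
                                  length xs + length (filter (_∈? S) ys)
    inside-or-outside xs ys rewrite filter-++ (_∈? S) xs ys
                                  | length-++ (filter (_∈? S) xs) {filter (_∈? S) ys}
                                  | sym (length-filter-¬ (_∈? S) xs) = eq (length (filter (_∈? S) xs)) _ _
      where
      eq : ∀ a b c → a + b + c ≡ a + c + b
      eq = solve-∀

    -- Each vertex of `R` gives an edge upwards exactly when its parent is outside `S`, and each of
    -- its children either lies in `S` or gives an edge downwards.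
    length-boundary+inside : ∀ R → length (boundary R) + length (filter (_∈? S) (allChildren R))
                                 ≡ length (filter (λ x → ¬? (parent x ∈? S)) R) + length (allChildren R)
    length-boundary+inside []      = refl
    length-boundary+inside (x ∷ R) = begin
      length (boundary (x ∷ R)) + length inner
        ≡⟨ cong (_+ length inner) (length-boundary x R) ⟩
      length (outside (neighbours x)) + length (boundary R) + length inner
        ≡⟨ step ⟩
      length (filter topless (x ∷ R)) + (length (children x) + length (allChildren R))
        ≡⟨ cong (length (filter topless (x ∷ R)) +_) (sym (length-++ (children x))) ⟩
      length (filter topless (x ∷ R)) + length (allChildren (x ∷ R)) ∎
      where
      open ≡-Reasoning
      topless = λ x → ¬? (parent x ∈? S)
      inner = filter (_∈? S) (allChildren (x ∷ R))
      o = length (outside (children x))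
      c = length (boundary R)
      k = length (children x)
      i = length (filter (_∈? S) (allChildren R))
      t = length (filter topless R)
      a = length (allChildren R)
      core : o + c + length inner ≡ t + (k + a)
      core = trans (eq₁ o c (length inner)) (trans (cong (c +_) (inside-or-outside (children x) (allChildren R)))
               (trans (eq₂ c k i) (trans (cong (k +_) (length-boundary+inside R)) (eq₂ k t a))))
        where
        eq₁ : ∀ o c l → o + c + l ≡ c + (l + o)
        eq₁ = solve-∀
        eq₂ : ∀ c k i → c + (k + i) ≡ k + (c + i)
        eq₂ = solve-∀
      step : length (outside (neighbours x)) + c + length inner ≡ length (filter topless (x ∷ R)) + (k + a)
      step with parent x ∈? S
      ... | yes _ = core
      ... | no  _ = cong suc core

    module _ (u : Unique S) where

      attached-unique : Unique attached
      attached-unique = Unique.filter⁺ (λ x → parent x ∈? S) u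

      children-in-S : length (filter (_∈? S) (allChildren S)) ≡ length attached
      children-in-S = ≤-antisym
        (unique-⊆⇒length≤ (Unique.filter⁺ (_∈? S) (allChildren-unique u))
          (λ p → let q , r = ∈-filter⁻ (_∈? S) {xs = allChildren S} p in
            ∈-filter⁺ (λ x → parent x ∈? S) r (∈-allChildren⁻ q)))
        (unique-⊆⇒length≤ attached-unique
          (λ p → let q , r = ∈-filter⁻ (λ x → parent x ∈? S) {xs = S} p in
            ∈-filter⁺ (_∈? S) (∈-allChildren⁺ r) q))

      -- Boundary edges and attached vertices together number the tops plus all children. There are
      -- 2n - 2L children and n - K attached vertices; the latter are added to both sides to avoid
      -- subtraction.
      cut-size : length (cut S) + 2 * leaves# ≡ length S + 2 * tops#
      cut-size = +-cancelʳ-≡ (length attached) _ _ (begin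
        c + 2 * leaves# + length attached      ≡⟨ eq₁ c leaves# (length attached) ⟩
        c + length attached + 2 * leaves#      ≡⟨ cong (λ k → c + k + 2 * leaves#) (sym children-in-S) ⟩
        c + length (filter (_∈? S) (allChildren S)) + 2 * leaves# ≡⟨ cong (_+ 2 * leaves#) (length-boundary+inside S) ⟩
        tops# + length (allChildren S) + 2 * leaves# ≡⟨ +-assoc tops# _ _ ⟩
        tops# + (length (allChildren S) + 2 * leaves#) ≡⟨ cong (tops# +_) (length-allChildren S) ⟩
        tops# + 2 * length S                   ≡⟨ eq₂ tops# (length S) ⟩
        length S + tops# + length S            ≡⟨ cong (length S + tops# +_) (sym attached+tops) ⟩
        length S + tops# + (length attached + tops#) ≡⟨ eq₃ (length S) tops# (length attached) ⟩
        length S + 2 * tops# + length attached ∎)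
        where
        open ≡-Reasoning
        c = length (cut S)
        eq₁ : ∀ c l a → c + 2 * l + a ≡ c + a + 2 * l
        eq₁ = solve-∀
        eq₂ : ∀ t n → t + 2 * n ≡ n + t + n
        eq₂ = solve-∀
        eq₃ : ∀ n t a → n + t + (a + t) ≡ n + 2 * t + a
        eq₃ = solve-∀

      attached≤ : length attached + 2 * leaves# ≤ 2 * length S
      attached≤ = begin
        length attached + 2 * leaves#           ≤⟨ +-monoˡ-≤ (2 * leaves#) (unique-⊆⇒length≤ attached-unique
                                                     λ p → ∈-allChildren⁺ (proj₂ (∈-filter⁻ (λ x → parent x ∈? S) {xs = S} p))) ⟩
        length (allChildren S) + 2 * leaves#    ≡⟨ length-allChildren S ⟩
        2 * length S                            ∎
        where open ≤-Reasoning

      attached-atLevel : ∀ i → length (atLevel i attached) ≤ length (atLevel (suc i) S) + length (atLevel (suc i) S)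
      attached-atLevel i = begin
        length (atLevel i attached)                    ≤⟨ unique-⊆⇒length≤ (Unique.filter⁺ (λ x → level x ≟ i) attached-unique) f ⟩
        length (allChildren (atLevel (suc i) S))       ≡⟨ length-allChildren-atLevel i S ⟩
        2 * length (atLevel (suc i) S)                 ≡⟨ sym (double (length (atLevel (suc i) S))) ⟩
        length (atLevel (suc i) S) + length (atLevel (suc i) S) ∎
        where
        open ≤-Reasoning
        f : ∀ {x} → x ∈ atLevel i attached → x ∈ allChildren (atLevel (suc i) S)
        f p = let q , l = ∈-filter⁻ (λ x → level x ≟ i) {xs = attached} p
                  _ , r = ∈-filter⁻ (λ x → parent x ∈? S) {xs = S} q
              in ∈-allChildren⁺ (∈-filter⁺ (λ x → level x ≟ suc i) r (cong suc l))

      atLevel-split : ∀ i → length (atLevel i attached) + length (atLevel i tops) ≡ length (atLevel i S)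
      atLevel-split i = length-filter-filter-¬ (λ x → parent x ∈? S) (λ x → level x ≟ i) S

      -- Induction from the highest level down, `d` bounding the number of occupied levels from `i`
      -- upwards. Above all of `S` a level is empty, so there is no positive leaf count to split.
      splits-from : ∀ d i → (∀ {x} → x ∈ S → level x < i + d) →
        Splits (length (atLevel i S)) (length (fromLevel i tops)) (length (fromLevel i S))
      splits-from zero i bound a′ 0<a′ a′≤
        rewrite filter-none (λ x → level x ≟ i) {S}
                  (All.tabulate λ p l → <-irrefl l (subst (_ <_) (+-identityʳ i) (bound p))) =
        contradiction 0<a′ (≤⇒≯ a′≤)
      splits-from (suc d) i bound
        rewrite length-fromLevel i S | length-fromLevel i tops | sym (atLevel-split i) =
        splits-down (length (atLevel i attached)) (length (atLevel i tops)) (attached-atLevel i)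
          (splits-from d (suc i) (λ {x} p → subst (level x <_) (+-suc i d) (bound p)))

      splits : Splits leaves# tops# (length S)
      splits with levels-bounded S
      ... | H , bound = subst₂ (λ K n → Splits leaves# (length K) (length n))
                          (fromLevel-0 tops) (fromLevel-0 S) (splits-from H 0 bound)

      -- Sets closed under children.

      module _ (closed : ∀ {x} → parent x ∈ S → x ∈ S) where

        closed-atLevel : ∀ i → length (atLevel (suc i) S) + length (atLevel (suc i) S) ≤ length (atLevel i S)
        closed-atLevel i = begin
          length (atLevel (suc i) S) + length (atLevel (suc i) S) ≡⟨ double (length (atLevel (suc i) S)) ⟩
          2 * length (atLevel (suc i) S)                 ≡⟨ sym (length-allChildren-atLevel i S) ⟩
          length (allChildren (atLevel (suc i) S))       ≤⟨ unique-⊆⇒length≤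
                                                              (allChildren-unique (Unique.filter⁺ (λ x → level x ≟ suc i) u)) f ⟩
          length (atLevel i S)                           ∎
          where
          open ≤-Reasoning
          f : ∀ {x} → x ∈ allChildren (atLevel (suc i) S) → x ∈ atLevel i S
          f p = let q , l = ∈-filter⁻ (λ x → level x ≟ suc i) {xs = S} (∈-allChildren⁻ p)
                in ∈-filter⁺ (λ x → level x ≟ i) (closed q) (suc-injective l)

        closed-size-from : ∀ d i → (∀ {x} → x ∈ S → level x < i + d) →
                           length (fromLevel i S) ≤ σ 0 (length (atLevel i S))
        closed-size-from zero i bound
          rewrite filter-none (λ x → i ≤? level x) {S}
                    (All.tabulate λ p l → <⇒≱ (subst (_ <_) (+-identityʳ i) (bound p)) l) = z≤n
        closed-size-from (suc d) i bound rewrite length-fromLevel i S =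
          ≤-trans (+-monoʳ-≤ (length (atLevel i S))
                    (closed-size-from d (suc i) (λ {x} p → subst (level x <_) (+-suc i d) (bound p))))
                  (σ₀-step (length (atLevel i S)) {length (atLevel (suc i) S)} (closed-atLevel i))

        closed-size : length S ≤ σ 0 leaves#
        closed-size with levels-bounded S
        ... | H , bound = subst (λ R → length R ≤ σ 0 leaves#) (fromLevel-0 S) (closed-size-from H 0 bound)

  -- Connected sets.

  module _ {S : List Vertex} (conn : Connected S) where

    -- Along a path in S starting at a top, the ancestors up to that top stay in S.
    data Below (t : Vertex) : Vertex → Set where
      start   : Below t t
      descend : ∀ {x} → parent x ∈ S → Below t (parent x) → Below t x

    below-path : ∀ {t x y} → parent t ∉ S → Below t x → Star (λ a b → a ∈ S × b ∈ S × Adjacent a b) x y → Below t y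
    below-path t∉ b ε = b
    below-path t∉ start         ((_ , q , inj₁ refl) ◅ path) = contradiction q t∉
    below-path t∉ (descend _ b) ((_ , _ , inj₁ refl) ◅ path) = below-path t∉ b path
    below-path t∉ b             ((p , _ , inj₂ refl) ◅ path) = below-path t∉ (descend p b) path

    -- A path in `S` puts `y` below `x`, and a vertex strictly below has its parent in `S`, so it is
    -- no top.
    top-unique : ∀ {x y} → x ∈ tops S → y ∈ tops S → x ≡ y
    top-unique {x} {y} x∈ y∈ with ∈-filter⁻ (λ x → ¬? (parent x ∈? S)) {xs = S} x∈
                                | ∈-filter⁻ (λ x → ¬? (parent x ∈? S)) {xs = S} y∈
    ... | x∈S , px∉ | y∈S , py∉ with below-path px∉ start (conn x y x∈S y∈S)
    ...   | start        = refl
    ...   | descend py _ = contradiction py py∉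

    tops≤1 : Unique S → tops# S ≤ 1
    tops≤1 u = go (tops S) (Unique.filter⁺ (λ x → ¬? (parent x ∈? S)) u) top-unique
      where
      go : ∀ R → Unique R → (∀ {x y} → x ∈ R → y ∈ R → x ≡ y) → length R ≤ 1
      go []          _              _  = z≤n
      go (x ∷ [])    _              _  = s≤s z≤n
      go (x ∷ y ∷ R) ((x≢y ∷ _) ∷ _) eq = contradiction (eq (here refl) (there (here refl))) x≢y

  -- Sets with connected complement.

  ancestor : ℕ → Vertex → Vertex
  ancestor zero    x = x
  ancestor (suc k) x = ancestor k (parent x)

  level-ancestor : ∀ k x → level (ancestor k x) ≡ k + level x
  level-ancestor zero    x = refl
  level-ancestor (suc k) x = trans (level-ancestor k (parent x)) (+-suc k (level x))

  -- A path avoiding S cannot leave the subtree of x through parent x ∈ S.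
  avoiding-path : ∀ {S : List Vertex} {x y z} → parent x ∈ S → (∃ λ k → ancestor k y ≡ x) →
                  Star (λ a b → a ∉ S × b ∉ S × Adjacent a b) y z → ∃ λ k → ancestor k z ≡ x
  avoiding-path px∈ d ε = d
  avoiding-path px∈ (zero  , refl) ((_ , q , inj₁ refl) ◅ path) = contradiction px∈ q
  avoiding-path px∈ (suc k , eq)   ((_ , _ , inj₁ refl) ◅ path) = avoiding-path px∈ (k , eq) path
  avoiding-path px∈ (k     , eq)   ((_ , _ , inj₂ refl) ◅ path) = avoiding-path px∈ (suc k , eq) path

  -- If `x` were outside `S` under a parent in `S`, a path in the complement would join it to `far`,
  -- an ancestor above every level of `S`. Such a path stays below `x`, but `far` lies higher than
  -- `x`.
  coconnected⇒closed : ∀ {S} → CoConnected S → ∀ {x} → parent x ∈ S → x ∈ S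
  coconnected⇒closed {S} coconn {x} px∈S with x ∈? S | levels-bounded S
  ... | yes x∈S | _ = x∈S
  ... | no  x∉S | H , bound = contradiction (avoiding-path px∈S (0 , refl) (coconn x far x∉S far∉S)) not-below
    where
    far : Vertex
    far = ancestor (suc H) x
    x<far : H + level x < level far
    x<far = ≤-reflexive (sym (level-ancestor (suc H) x))
    far∉S : far ∉ S
    far∉S p = <⇒≱ (bound p) (≤-trans (m≤m+n H (level x)) (<⇒≤ x<far))
    not-below : ¬ ∃ λ k → ancestor k far ≡ x
    not-below (k , eq) = <⇒≱ x<far (begin
      level far                 ≤⟨ m≤n+m (level far) k ⟩
      k + level far             ≡⟨ sym (level-ancestor k far) ⟩
      level (ancestor k far)    ≡⟨ cong level eq ⟩
      level x                   ≤⟨ m≤n+m (level x) H ⟩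
      H + level x               ∎)
      where open ≤-Reasoning

open Cuts

-- Staircases: sets given by the widths of their rows.

module Staircases where

  open import Data.Nat.Base using (_+_; _*_)
  open import Data.Product.Base using (_×_)

  row : ℕ → ℕ → List Vertex
  row i w = map (i ,_) (upTo w)

  stair : ℕ → List ℕ → List Vertex
  stair i []       = []
  stair i (w ∷ ws) = row i w ++ stair (suc i) ws

  width : List ℕ → ℕ
  width []      = 0
  width (w ∷ _) = w

  -- Bounds the number of tops: in each row, only columns from twice the next width onwards lack a
  -- parent in the next row.
  excess : List ℕ → ℕ
  excess []       = 0
  excess (w ∷ ws) = (w ∸ 2 * width ws) + excess ws

  ∈-row⁺ : ∀ {i j w} → j < w → (i , j) ∈ row i w
  ∈-row⁺ p = ∈-map⁺ (_ ,_) (∈-upTo⁺ p)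

  ∈-row⁻ : ∀ {x i w} → x ∈ row i w → level x ≡ i × proj₂ x < w
  ∈-row⁻ p with ∈-map⁻ (_ ,_) p
  ... | j , q , refl = refl , ∈-upTo⁻ q

  ∈-stair-width : ∀ {i j} ws → j < width ws → (i , j) ∈ stair i ws
  ∈-stair-width (w ∷ ws) p = ∈-++⁺ˡ (∈-row⁺ p)

  stair-level : ∀ {x} i ws → x ∈ stair i ws → i ≤ level x
  stair-level i (w ∷ ws) p with ∈-++⁻ (row i w) p
  ... | inj₁ q = ≤-reflexive (sym (proj₁ (∈-row⁻ q)))
  ... | inj₂ q = <⇒≤ (stair-level (suc i) ws q)

  row-unique : ∀ i w → Unique (row i w)
  row-unique i w = Unique.map⁺ (cong proj₂) (Unique.upTo⁺ w)

  stair-unique : ∀ i ws → Unique (stair i ws)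
  stair-unique i []       = []
  stair-unique i (w ∷ ws) = Unique.++⁺ (row-unique i w) (stair-unique (suc i) ws)
    λ (p , q) → <-irrefl (sym (proj₁ (∈-row⁻ p))) (stair-level (suc i) ws q)

  length-row : ∀ i w → length (row i w) ≡ w
  length-row i w = trans (length-map (i ,_) (upTo w)) (length-upTo w)

  length-stair : ∀ i ws → length (stair i ws) ≡ sum ws
  length-stair i []       = refl
  length-stair i (w ∷ ws) = trans (length-++ (row i w)) (cong₂ _+_ (length-row i w) (length-stair (suc i) ws))

  <⇒⌊/2⌋< : ∀ {j w} → j < 2 * w → ⌊ j /2⌋ < w
  <⇒⌊/2⌋< {j} {w} p = *-cancelˡ-< 2 _ _ (begin-strict
    2 * ⌊ j /2⌋         ≡⟨ sym (double ⌊ j /2⌋) ⟩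
    ⌊ j /2⌋ + ⌊ j /2⌋   ≤⟨ ⌊/2⌋-double j ⟩
    j                   <⟨ p ⟩
    2 * w               ∎)
    where open ≤-Reasoning

  ⌊/2⌋<⇒< : ∀ {j w} → ⌊ j /2⌋ < w → j < 2 * w
  ⌊/2⌋<⇒< {j} {w} p = ≰⇒> λ q → <⇒≱ p (begin
    w             ≡⟨ n≡⌊n+n/2⌋ w ⟩
    ⌊ w + w /2⌋   ≤⟨ ⌊n/2⌋-mono (≤-trans (≤-reflexive (double w)) q) ⟩
    ⌊ j /2⌋       ∎)
    where open ≤-Reasoning

  parentless : ℕ → List ℕ → List Vertex
  parentless i []       = []
  parentless i (w ∷ ws) = map (λ j → i , 2 * width ws + j) (upTo (w ∸ 2 * width ws)) ++ parentless (suc i) ws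

  length-parentless : ∀ i ws → length (parentless i ws) ≡ excess ws
  length-parentless i []       = refl
  length-parentless i (w ∷ ws) = trans (length-++ (map (λ j → i , 2 * width ws + j) (upTo (w ∸ 2 * width ws))))
    (cong₂ _+_ (trans (length-map _ (upTo (w ∸ 2 * width ws))) (length-upTo _)) (length-parentless (suc i) ws))

  -- `S` remains the whole staircase while the induction discards rows, so membership of the parent
  -- keeps its meaning.
  ∈-parentless : ∀ {S x} i ws → (∀ {y} → y ∈ stair i ws → y ∈ S) →
                 x ∈ stair i ws → parent x ∉ S → x ∈ parentless i ws
  ∈-parentless {S} {x} i (w ∷ ws) sub x∈ p∉ with ∈-++⁻ (row i w) x∈
  ... | inj₂ q = ∈-++⁺ʳ (map _ (upTo _)) (∈-parentless (suc i) ws (sub ∘ ∈-++⁺ʳ (row i w)) q p∉)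
  ... | inj₁ q with ∈-row⁻ q
  ...   | refl , j<w = ∈-++⁺ˡ (subst (λ k → (i , k) ∈ map (λ j → i , 2 * width ws + j) (upTo (w ∸ 2 * width ws)))
                         (m+[n∸m]≡n 2w≤j) (∈-map⁺ (λ j → i , 2 * width ws + j) (∈-upTo⁺ (∸-monoˡ-< j<w 2w≤j))))
    where
    2w≤j : 2 * width ws ≤ proj₂ x
    2w≤j = ≮⇒≥ λ j<2w → p∉ (sub (∈-++⁺ʳ (row i w) (∈-stair-width ws (<⇒⌊/2⌋< j<2w))))

  width≤leaves : ∀ ws → width ws ≤ leaves# (stair 0 ws)
  width≤leaves []       = z≤n
  width≤leaves (w ∷ ws) = subst (_≤ leaves# (stair 0 (w ∷ ws))) (length-row 0 w)
    (unique-⊆⇒length≤ (row-unique 0 w) λ p →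
      ∈-filter⁺ (λ x → level x ≟ 0) (∈-++⁺ˡ p) (proj₁ (∈-row⁻ p)))

  tops≤excess : ∀ ws → tops# (stair 0 ws) ≤ excess ws
  tops≤excess ws = subst (tops# S ≤_) (length-parentless 0 ws)
    (unique-⊆⇒length≤ (Unique.filter⁺ (λ x → ¬? (parent x ∈? S)) (stair-unique 0 ws)) λ p →
      let q , r = ∈-filter⁻ (λ x → ¬? (parent x ∈? S)) {xs = S} p in ∈-parentless 0 ws id q r)
    where S = stair 0 ws

  stair-cut : ∀ ws {k} → sum ws + 2 * excess ws ≤ 2 * width ws + k → length (cut (stair 0 ws)) ≤ k
  stair-cut ws {k} p = +-cancelʳ-≤ (2 * width ws) _ _ (begin
    length (cut S) + 2 * width ws   ≤⟨ +-monoʳ-≤ (length (cut S)) (*-monoʳ-≤ 2 (width≤leaves ws)) ⟩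
    length (cut S) + 2 * leaves# S  ≡⟨ cut-size S (stair-unique 0 ws) ⟩
    length S + 2 * tops# S          ≤⟨ +-mono-≤ (≤-reflexive (length-stair 0 ws)) (*-monoʳ-≤ 2 (tops≤excess ws)) ⟩
    sum ws + 2 * excess ws          ≤⟨ p ⟩
    2 * width ws + k                ≡⟨ +-comm _ k ⟩
    k + 2 * width ws                ∎)
    where
    open ≤-Reasoning
    S = stair 0 ws

  -- Addition of width sequences.

  _⊕_ : List ℕ → List ℕ → List ℕ
  []       ⊕ ys       = ys
  (x ∷ xs) ⊕ []       = x ∷ xs
  (x ∷ xs) ⊕ (y ∷ ys) = (x + y) ∷ (xs ⊕ ys)

  width-⊕ : ∀ xs ys → width (xs ⊕ ys) ≡ width xs + width ys
  width-⊕ []       ys       = refl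
  width-⊕ (x ∷ xs) []       = sym (+-identityʳ x)
  width-⊕ (x ∷ xs) (y ∷ ys) = refl

  sum-⊕ : ∀ xs ys → sum (xs ⊕ ys) ≡ sum xs + sum ys
  sum-⊕ []       ys       = refl
  sum-⊕ (x ∷ xs) []       = sym (+-identityʳ _)
  sum-⊕ (x ∷ xs) (y ∷ ys) rewrite sum-⊕ xs ys = eq x y (sum xs) (sum ys)
    where
    eq : ∀ x y a b → x + y + (a + b) ≡ x + a + (y + b)
    eq = solve-∀

  m+n∸o+p≤ : ∀ m n o p → (m + n) ∸ (o + p) ≤ (m ∸ o) + (n ∸ p)
  m+n∸o+p≤ m n o p = m≤n+o⇒m∸n≤o (m + n) (o + p) (begin
    m + n                            ≤⟨ +-mono-≤ (m≤n+m∸n m o) (m≤n+m∸n n p) ⟩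
    (o + (m ∸ o)) + (p + (n ∸ p))    ≡⟨ eq o (m ∸ o) p (n ∸ p) ⟩
    (o + p) + ((m ∸ o) + (n ∸ p))    ∎)
    where
    open ≤-Reasoning
    eq : ∀ o a p b → (o + a) + (p + b) ≡ (o + p) + (a + b)
    eq = solve-∀

  -- Truncated subtraction is subadditive: a surplus in one sequence can only be absorbed by slack
  -- in the other.
  excess-⊕ : ∀ xs ys → excess (xs ⊕ ys) ≤ excess xs + excess ys
  excess-⊕ []       ys       = ≤-refl
  excess-⊕ (x ∷ xs) []       = ≤-reflexive (sym (+-identityʳ _))
  excess-⊕ (x ∷ xs) (y ∷ ys) rewrite width-⊕ xs ys | *-distribˡ-+ 2 (width xs) (width ys) =
    ≤-trans (+-mono-≤ (m+n∸o+p≤ x y (2 * width xs) (2 * width ys)) (excess-⊕ xs ys))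
            (≤-reflexive (eq (x ∸ 2 * width xs) _ (excess xs) _))
    where
    eq : ∀ a b c d → (a + b) + (c + d) ≡ (a + c) + (b + d)
    eq = solve-∀

  -- Connected staircases.

  data Tapering : List ℕ → Set where
    [1] : Tapering (1 ∷ [])
    _∷_ : ∀ {w ws} → w ≤ 2 * width ws → Tapering ws → Tapering (w ∷ ws)

  excess-tapering : ∀ {ws} → Tapering ws → excess ws ≡ 1
  excess-tapering [1]     = refl
  excess-tapering (p ∷ t) = cong₂ _+_ (m≤n⇒m∸n≡0 p) (excess-tapering t)

  -- Rows of ⌊x/2ⁱ⌋ + 1 vertices, ending with a row of width 1, use `suc (σ 1 x)` vertices; the `r`
  -- others form a path of further rows of width 1 at the top.
  tapering-widths : ∀ x r → ∃ λ ws → Tapering ws × width ws ≡ suc x × sum ws ≡ suc (σ 1 x) + r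
  tapering-widths = halving-rec (λ x → ∀ r → ∃ λ ws → Tapering ws × width ws ≡ suc x × sum ws ≡ suc (σ 1 x) + r) path grow
    where
    path : ∀ r → ∃ λ ws → Tapering ws × width ws ≡ 1 × sum ws ≡ suc r
    path zero = 1 ∷ [] , [1] , refl , refl
    path (suc r) with path r
    ... | ws , t , w≡ , s≡ = 1 ∷ ws , subst (λ w → 1 ≤ 2 * w) (sym w≡) (s≤s z≤n) ∷ t , refl , cong suc s≡
    grow : ∀ x → (∀ r → ∃ λ ws → Tapering ws × width ws ≡ suc ⌊ suc x /2⌋ × sum ws ≡ suc (σ 1 ⌊ suc x /2⌋) + r) →
           ∀ r → ∃ λ ws → Tapering ws × width ws ≡ suc (suc x) × sum ws ≡ suc (σ 1 (suc x)) + r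
    grow x ih r with ih r
    ... | ws , t , w≡ , s≡ = suc (suc x) ∷ ws
      , subst (λ w → suc (suc x) ≤ 2 * w) (sym w≡) (⌊/2⌋<⇒< ≤-refl) ∷ t
      , refl
      , trans (cong (suc (suc x) +_) s≡)
          (trans (eq x (σ 1 ⌊ suc x /2⌋) r) (cong (λ s → suc s + r) (sym (σ-suc 1 x))))
      where
      eq : ∀ x s r → suc (suc x) + (suc s + r) ≡ suc (1 + suc x + s) + r
      eq = solve-∀

  Step : (Vertex → Set) → Vertex → Vertex → Set
  Step P a b = P a × P b × Adjacent a b

  step-sym : ∀ {P a b} → Step P a b → Step P b a
  step-sym (p , q , inj₁ e) = q , p , inj₂ e
  step-sym (p , q , inj₂ e) = q , p , inj₁ e

  apex : ℕ → List ℕ → Vertex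
  apex i []           = i , 0
  apex i (w ∷ [])     = i , 0
  apex i (w ∷ v ∷ ws) = apex (suc i) (v ∷ ws)

  tapering⇒apex : ∀ {S} i {ws} → Tapering ws → (∀ {y} → y ∈ stair i ws → y ∈ S) →
                  ∀ {x} → x ∈ stair i ws → Star (Step (_∈ S)) x (apex i ws)
  tapering⇒apex i [1] sub (here refl) = ε
  tapering⇒apex i {w ∷ v ∷ ws} (p ∷ t) sub {x} x∈ with ∈-++⁻ (row i w) x∈
  ... | inj₂ q = tapering⇒apex (suc i) t (sub ∘ ∈-++⁺ʳ (row i w)) q
  ... | inj₁ q with ∈-row⁻ q
  ...   | refl , j<w = (sub x∈ , sub (∈-++⁺ʳ (row i w) px∈) , inj₁ refl) ◅ tapering⇒apex (suc i) t (sub ∘ ∈-++⁺ʳ (row i w)) px∈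
    where
    px∈ : parent x ∈ stair (suc i) (v ∷ ws)
    px∈ = ∈-stair-width (v ∷ ws) (<⇒⌊/2⌋< (<-≤-trans j<w p))

  tapering⇒connected : ∀ {ws} → Tapering ws → Connected (stair 0 ws)
  tapering⇒connected t x y x∈ y∈ = tapering⇒apex 0 t id x∈ ◅◅ reverse (step-sym {_∈ _}) (tapering⇒apex 0 t id y∈)

  -- Staircases with connected complement.

  data Halving : List ℕ → Set where
    []  : Halving []
    _∷_ : ∀ {w ws} → 2 * width ws ≤ w → Halving ws → Halving (w ∷ ws)

  -- No subtraction in `excess` truncates here, so the sum telescopes.
  excess-halving : ∀ {ws} → Halving ws → excess ws + sum ws ≡ 2 * width ws
  excess-halving []                    = refl
  excess-halving {w ∷ ws} (p ∷ h) = begin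
    (w ∸ 2 * width ws) + excess ws + (w + sum ws)    ≡⟨ eq (w ∸ 2 * width ws) (excess ws) w (sum ws) ⟩
    (w ∸ 2 * width ws) + (excess ws + sum ws) + w    ≡⟨ cong (λ k → (w ∸ 2 * width ws) + k + w) (excess-halving h) ⟩
    (w ∸ 2 * width ws) + 2 * width ws + w            ≡⟨ cong (_+ w) (m∸n+n≡m p) ⟩
    w + w                                            ≡⟨ double w ⟩
    2 * w                                            ∎
    where
    open ≡-Reasoning
    eq : ∀ a e w s → a + e + (w + s) ≡ a + (e + s) + w
    eq = solve-∀

  -- The bottom row has width `C v` and the rest is built recursively. It fits: `v ≤ σ 0 (C v)`, so
  -- the remaining vertices number at most `σ 0 ⌊ C v /2⌋`, and by `C-lower` their bottom row is at
  -- most half as wide.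
  halving-widths : ∀ v → ∃ λ ws → Halving ws × width ws ≡ C v × sum ws ≡ v
  halving-widths = <-rec (λ v → ∃ λ ws → Halving ws × width ws ≡ C v × sum ws ≡ v) build
    where
    build : ∀ v → (∀ {u} → u < v → ∃ λ ws → Halving ws × width ws ≡ C u × sum ws ≡ u) →
            ∃ λ ws → Halving ws × width ws ≡ C v × sum ws ≡ v
    build zero    _  = [] , [] , refl , refl
    build (suc v) ih = extend (C (suc v)) refl (subst (0 <_) (sym (C≡count (suc v))) (count-pos 0 v))
      where
      extend : ∀ k → C (suc v) ≡ k → 0 < k → ∃ λ ws → Halving ws × width ws ≡ C (suc v) × sum ws ≡ suc v
      extend (suc k) eq _ with ih {v ∸ k} (s≤s (m∸n≤m v k))
      ... | ws , h , w≡ , s≡ = suc k ∷ ws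
        , (begin
            2 * width ws                          ≡⟨ cong (2 *_) w≡ ⟩
            2 * C (v ∸ k)                         ≤⟨ *-monoʳ-≤ 2 (C-lower {v ∸ k} {⌊ suc k /2⌋} rest) ⟩
            2 * ⌊ suc k /2⌋                       ≡⟨ sym (double ⌊ suc k /2⌋) ⟩
            ⌊ suc k /2⌋ + ⌊ suc k /2⌋             ≤⟨ ⌊/2⌋-double (suc k) ⟩
            suc k                                 ∎) ∷ h
        , sym eq
        , trans (cong (suc k +_) s≡) (cong suc (m+[n∸m]≡n k≤v))
        where
        open ≤-Reasoning
        rest : v ∸ k ≤ σ 0 ⌊ suc k /2⌋
        rest = m≤n+o⇒m∸n≤o v k (≤-pred (begin
          suc v                        ≤⟨ C-gap (suc v) ⟩
          σ 0 (C (suc v))              ≡⟨ cong (σ 0) eq ⟩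
          σ 0 (suc k)                  ≡⟨ σ-suc 0 k ⟩
          suc k + σ 0 ⌊ suc k /2⌋      ∎))
        k≤v : k ≤ v
        k≤v = ≤-pred (≤-trans (≤-reflexive (trans (sym eq) (C≡count (suc v)))) (count≤ 0 (suc v)))

  halving⇒closed-from : ∀ i {w ws x} → Halving (w ∷ ws) → parent x ∈ stair (suc i) ws → x ∈ stair i (w ∷ ws)
  halving⇒closed-from i {w} {v ∷ vs} (p ∷ h) px∈ with ∈-++⁻ (row (suc i) v) px∈
  ... | inj₂ q = ∈-++⁺ʳ (row i w) (halving⇒closed-from (suc i) h q)
  ... | inj₁ q with ∈-row⁻ q
  ...   | refl , h<v = ∈-++⁺ˡ (∈-row⁺ (<-≤-trans (⌊/2⌋<⇒< h<v) p))

  halving⇒closed : ∀ {ws} → Halving ws → ∀ {x} → parent x ∈ stair 0 ws → x ∈ stair 0 ws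
  halving⇒closed {w ∷ ws} h px∈ with ∈-++⁻ (row 0 w) px∈
  ... | inj₁ q = contradiction (proj₁ (∈-row⁻ q)) λ ()
  ... | inj₂ q = halving⇒closed-from 0 h q

  -- Halving lowers every positive column, so `j` steps reach column 0.
  ancestor-column-0 : ∀ k i {j} → j ≤ k → ancestor k (i , j) ≡ (k + i , 0)
  ancestor-column-0 zero    i {zero}  _ = refl
  ancestor-column-0 (suc k) i {zero}  _ = trans (ancestor-column-0 k (suc i) z≤n) (cong (_, 0) (+-suc k i))
  ancestor-column-0 (suc k) i {suc j} (s≤s p) =
    trans (ancestor-column-0 k (suc i) (≤-trans (≤-pred (⌊n/2⌋<n j)) p)) (cong (_, 0) (+-suc k i))

  -- By closedness, climbing from a vertex outside `S` stays outside `S`; any two such climbs meet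
  -- in column 0.
  closed⇒coconnected : ∀ {S} → (∀ {x} → parent x ∈ S → x ∈ S) → CoConnected S
  closed⇒coconnected {S} closed x@(i , j) y@(i′ , j′) x∉ y∉ =
    climb k x x∉ ◅◅ subst (λ z → Star (Step (_∉ S)) z y) (sym meet) (reverse (step-sym {_∉ S}) (climb k′ y y∉))
    where
    climb : ∀ k z → z ∉ S → Star (Step (_∉ S)) z (ancestor k z)
    climb zero    z z∉ = ε
    climb (suc k) z z∉ = (z∉ , z∉ ∘ closed , inj₁ refl) ◅ climb k (parent z) (z∉ ∘ closed)
    -- Chosen so that `k + i` equals `k′ + i′` while `k` is at least `j` and `k′` at least `j′`:
    -- both climbs are in column 0 at the same level.
    k k′ : ℕ
    k  = j + j′ + i′
    k′ = j + j′ + i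
    meet : ancestor k x ≡ ancestor k′ y
    meet = begin
      ancestor k x       ≡⟨ ancestor-column-0 k i (≤-trans (m≤m+n j j′) (m≤m+n _ i′)) ⟩
      (k + i , 0)        ≡⟨ cong (_, 0) (eq (j + j′) i′ i) ⟩
      (k′ + i′ , 0)      ≡⟨ sym (ancestor-column-0 k′ i′ (≤-trans (m≤n+m j′ j) (m≤m+n _ i))) ⟩
      ancestor k′ y      ∎
      where
      open ≡-Reasoning
      eq : ∀ a b c → a + b + c ≡ a + c + b
      eq = solve-∀

  -- Minima, and width sequences that attain the bounds.

  min≤-≤ : ∀ n f {v} → v ≤ n → min≤ n f ≤ f v
  min≤-≤ n f {v} p = All.lookup (ℕExtrema.min≤xs (f 0) (map f (upTo (suc n)))) (∈-map⁺ f (∈-upTo⁺ (s≤s p)))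

  min≤-attained : ∀ n f → ∃ λ v → v ≤ n × min≤ n f ≡ f v
  min≤-attained n f with ℕExtrema.argmin-sel id (f 0) (map f (upTo (suc n)))
  -- The default element of the minimum is `f 0`, attained at 0.
  ... | inj₁ eq = 0 , z≤n , eq
  ... | inj₂ m∈ with ∈-map⁻ f m∈
  ...   | v , v∈ , eq = v , ≤-pred (∈-upTo⁻ v∈) , eq

  -- The inequality is the hypothesis of `stair-cut`, free of subtraction so that `cheap-⊕` can add
  -- two of them.
  Cheap : ℕ → ℕ → List ℕ → Set
  Cheap n k ws = sum ws ≡ n × sum ws + 2 * excess ws ≤ 2 * width ws + k

  cheap-⊕ : ∀ {m n k l xs ys} → Cheap m k xs → Cheap n l ys → Cheap (m + n) (k + l) (xs ⊕ ys)
  cheap-⊕ {k = k} {l} {xs} {ys} (refl , p) (refl , q) rewrite sum-⊕ xs ys | width-⊕ xs ys = refl , (begin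
    sum xs + sum ys + 2 * excess (xs ⊕ ys)                  ≤⟨ +-monoʳ-≤ (sum xs + sum ys) (*-monoʳ-≤ 2 (excess-⊕ xs ys)) ⟩
    sum xs + sum ys + 2 * (excess xs + excess ys)           ≡⟨ eq₁ (sum xs) (sum ys) (excess xs) (excess ys) ⟩
    (sum xs + 2 * excess xs) + (sum ys + 2 * excess ys)     ≤⟨ +-mono-≤ p q ⟩
    (2 * width xs + k) + (2 * width ys + l)                 ≡⟨ eq₂ (width xs) (width ys) k l ⟩
    2 * (width xs + width ys) + (k + l)                     ∎)
    where
    open ≤-Reasoning
    eq₁ : ∀ a b c d → a + b + 2 * (c + d) ≡ (a + 2 * c) + (b + 2 * d)
    eq₁ = solve-∀
    eq₂ : ∀ a b k l → (2 * a + k) + (2 * b + l) ≡ 2 * (a + b) + (k + l)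
    eq₂ = solve-∀

  cheap-halving : ∀ v → ∃ λ ws → Halving ws × Cheap v (δP′ v) ws
  cheap-halving v with halving-widths v
  ... | ws , h , w≡ , s≡ = ws , h , s≡ , ≤-reflexive (begin
    sum ws + 2 * excess ws               ≡⟨ eq (sum ws) (excess ws) ⟩
    (excess ws + sum ws) + excess ws     ≡⟨ cong₂ _+_ (excess-halving h) excess≡ ⟩
    2 * width ws + δP′ v                 ∎)
    where
    open ≡-Reasoning
    eq : ∀ s e → s + 2 * e ≡ (e + s) + e
    eq = solve-∀
    excess≡ : excess ws ≡ δP′ v
    excess≡ = +-cancelʳ-≡ v _ _ (begin
      excess ws + v          ≡⟨ cong (excess ws +_) (sym s≡) ⟩
      excess ws + sum ws     ≡⟨ excess-halving h ⟩
      2 * width ws           ≡⟨ cong (2 *_) w≡ ⟩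
      2 * C v                ≡⟨ sym (δP′-eq v) ⟩
      δP′ v + v              ∎)

  cheap-tapering : ∀ n → ∃ λ ws → Tapering ws × Cheap (suc n) (δC′ (suc n)) ws
  cheap-tapering n with T-pred n
  -- The set gets `T (suc n)`, that is `suc x`, leaves; the `n ∸ σ 1 x` vertices left over lengthen
  -- the path at the top.
  ... | x , T≡ , p with tapering-widths x (n ∸ σ 1 x)
  ...   | ws , t , w≡ , s≡ = ws , t , sum≡ , ≤-reflexive (begin
    sum ws + 2 * excess ws               ≡⟨ cong₂ (λ s e → s + 2 * e) sum≡ (excess-tapering t) ⟩
    suc n + 2                            ≡⟨ sym (δC′-eq (suc n)) ⟩
    δC′ (suc n) + 2 * T (suc n)          ≡⟨ cong (λ k → δC′ (suc n) + 2 * k) (trans T≡ (sym w≡)) ⟩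
    δC′ (suc n) + 2 * width ws           ≡⟨ +-comm (δC′ (suc n)) _ ⟩
    2 * width ws + δC′ (suc n)           ∎)
    where
    open ≡-Reasoning
    sum≡ : sum ws ≡ suc n
    sum≡ = trans s≡ (cong suc (m+[n∸m]≡n p))

  cheap-δC : ∀ n → ∃ λ ws → Cheap n (δC′ n) ws
  -- Reached when `v` = `n` in the minimum: the connected part is then empty.
  cheap-δC zero    = [] , refl , z≤n
  cheap-δC (suc n) = let ws , _ , c = cheap-tapering n in ws , c

  cheap-δ : ∀ n → ∃ λ ws → Cheap n (δ′ n) ws
  cheap-δ n with min≤-attained n (cost n)
  ... | v , v≤n , eq with cheap-halving v | cheap-δC (n ∸ v)
  ...   | xs , _ , p | ys , q = xs ⊕ ys , subst₂ (λ m k → Cheap m k (xs ⊕ ys)) (m+[n∸m]≡n v≤n) (sym eq) (cheap-⊕ {xs = xs} {ys} p q)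

  -- Lower bounds for the cut, and the three minima.

  module _ {S : List Vertex} (u : Unique S) where

    private
      n = length S
      c = length (cut S)

      L = leaves# S

    -- Covers the sets to which `splits` does not apply, as it asks for a positive leaf count.
    leafless : L ≡ 0 → n ≤ c
    leafless L≡0 = begin
      n                  ≤⟨ m≤m+n n _ ⟩
      n + 2 * tops# S    ≡⟨ sym (cut-size S u) ⟩
      c + 2 * L          ≡⟨ cong (λ l → c + 2 * l) L≡0 ⟩
      c + 0              ≡⟨ +-identityʳ c ⟩
      c                  ∎
      where open ≤-Reasoning

    δC′≤cut : Connected S → δC′ n ≤ c
    δC′≤cut conn with m≤n⇒m<n∨m≡n (z≤n {L})
    ... | inj₂ 0≡L = ≤-trans (δC′≤ n) (leafless (sym 0≡L))
    ... | inj₁ 0<L with split⇒T (tops≤1 conn u) (splits S u L 0<L ≤-refl)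
    ...   | K≥1 , L≤T = +-cancelʳ-≤ (2 * L) _ _ (begin
      δC′ n + 2 * L         ≤⟨ +-monoʳ-≤ (δC′ n) (*-monoʳ-≤ 2 L≤T) ⟩
      δC′ n + 2 * T n       ≡⟨ δC′-eq n ⟩
      n + 2                 ≤⟨ +-monoʳ-≤ n (*-monoʳ-≤ 2 K≥1) ⟩
      n + 2 * tops# S       ≡⟨ sym (cut-size S u) ⟩
      c + 2 * L             ∎)
      where open ≤-Reasoning

    -- From `attached≤`, K is at least 2L - n, so the cut formula gives at least 2L - n edges;
    -- `closed-size` gives `C n ≤ L`. Terms are added to both sides to avoid subtraction.
    δP′≤cut : CoConnected S → δP′ n ≤ c
    δP′≤cut coconn = +-cancelʳ-≤ (n + 2 * L + 2 * a) _ _ (begin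
      δP′ n + (n + 2 * L + 2 * a)           ≡⟨ eq₁ (δP′ n) n L a ⟩
      (δP′ n + n) + 2 * (a + L)             ≡⟨ cong (_+ 2 * (a + L)) (δP′-eq n) ⟩
      2 * C n + 2 * (a + L)                 ≤⟨ +-monoˡ-≤ _ (*-monoʳ-≤ 2
                                                 (C-lower {n} {L} (closed-size S u (coconnected⇒closed coconn)))) ⟩
      2 * L + 2 * (a + L)                   ≡⟨ eq₂ L a ⟩
      2 * (a + 2 * L)                       ≤⟨ *-monoʳ-≤ 2 (attached≤ S u) ⟩
      2 * (2 * n)                           ≡⟨ eq₃ n ⟩
      2 * n + 2 * n                         ≡⟨ cong (λ k → 2 * n + 2 * k) (sym (attached+tops S)) ⟩
      2 * n + 2 * (a + K)                   ≡⟨ eq₄ n a K ⟩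
      (n + 2 * K) + (n + 2 * a)             ≡⟨ cong (_+ (n + 2 * a)) (sym (cut-size S u)) ⟩
      (c + 2 * L) + (n + 2 * a)             ≡⟨ eq₅ c L n a ⟩
      c + (n + 2 * L + 2 * a)               ∎)
      where
      open ≤-Reasoning
      K = tops# S
      a = length (attached S)
      eq₁ : ∀ d n L a → d + (n + 2 * L + 2 * a) ≡ (d + n) + 2 * (a + L)
      eq₁ = solve-∀
      eq₂ : ∀ L a → 2 * L + 2 * (a + L) ≡ 2 * (a + 2 * L)
      eq₂ = solve-∀
      eq₃ : ∀ n → 2 * (2 * n) ≡ 2 * n + 2 * n
      eq₃ = solve-∀
      eq₄ : ∀ n a K → 2 * n + 2 * (a + K) ≡ (n + 2 * K) + (n + 2 * a)
      eq₄ = solve-∀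
      eq₅ : ∀ c L n a → (c + 2 * L) + (n + 2 * a) ≡ c + (n + 2 * L + 2 * a)
      eq₅ = solve-∀

    δ′≤cut : δ′ n ≤ c
    δ′≤cut with m≤n⇒m<n∨m≡n (z≤n {L})
    -- At `v` = 0 the cost is `δC′ n`, because `δP′ 0` is 0.
    ... | inj₂ 0≡L = ≤-trans (min≤-≤ n (cost n) z≤n) (≤-trans (δC′≤ n) (leafless (sym 0≡L)))
    ... | inj₁ 0<L with split⇒δ (splits S u L 0<L ≤-refl)
    ...   | v , v≤n , p = ≤-trans (min≤-≤ n (cost n) v≤n) (+-cancelʳ-≤ (2 * L) _ _
      (≤-trans p (≤-reflexive (sym (cut-size S u)))))

  -- The cut of the staircase is at most `k` by `stair-cut`, and at least `k` because `lower`
  -- applies to the staircase as well.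
  isMinimum : ∀ {Q n k} → (∀ {S} → Unique S → Q S → length S ≡ n → k ≤ length (cut S)) →
              ∀ {ws} → Q (stair 0 ws) → Cheap n k ws → IsMinimum (CutSize Q n) k
  isMinimum {Q} {n} {k} lower {ws} q (s≡ , p) =
    (S , u , l , q , ≤-antisym (stair-cut ws p) (lower u q l)) ,
    λ { _ (R , uR , lR , qR , refl) → lower uR qR lR }
    where
    S = stair 0 ws
    u = stair-unique 0 ws
    l : length S ≡ n
    l = trans (length-stair 0 ws) s≡

  cutMinima : CutMinima
  cutMinima = record
    { δ       = δ′
    ; δP      = δP′
    ; δC      = δC′
    ; δ-min   = λ n _ → let ws , p = cheap-δ n in
        isMinimum (λ { u _ refl → δ′≤cut u }) {ws} tt p
    ; δP-min  = λ n _ → let ws , h , p = cheap-halving n in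
        isMinimum (λ { u q refl → δP′≤cut u q }) {ws} (closed⇒coconnected (halving⇒closed h)) p
    ; δC-min  = λ { (suc n) _ → let ws , t , p = cheap-tapering n in
        isMinimum (λ {S} u q l → subst (λ m → δC′ m ≤ length (cut S)) l (δC′≤cut u q)) {ws} (tapering⇒connected t) p }
    ; δP-zero = refl
    ; δC-zero = refl
    }

open Staircases

open import Data.Nat.Base using (ℕ; _≤_; _∸_) renaming (_+_ to _+ℕ_)
open import Data.Integer.Base using (+_; _+_; _-_; _*_)
open import Data.Product.Base using (Σ; _×_)
open import Relation.Binary.PropositionalEquality.Core using (_≡_)

-- Passage to the integers.

module ℤExtrema = Data.List.Extrema ℤ.≤-totalOrder

min≤ℤ-≤ : ∀ n f {v} → v ≤ n → min≤ℤ n f ℤ.≤ f v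
min≤ℤ-≤ n f {v} p = All.lookup (ℤExtrema.min≤xs (f 0) (map f (upTo (suc n)))) (∈-map⁺ f (∈-upTo⁺ (s≤s p)))

min≤ℤ-attained : ∀ n f → ∃ λ v → v ≤ n × min≤ℤ n f ≡ f v
min≤ℤ-attained n f with ℤExtrema.argmin-sel id (f 0) (map f (upTo (suc n)))
... | inj₁ eq = 0 , z≤n , eq
... | inj₂ m∈ with ∈-map⁻ f m∈
...   | v , v∈ , eq = v , ≤-pred (∈-upTo⁻ v∈) , eq

value : ℕ → ℕ → ℤ
value n v = + C v - + T (n ∸ v) - + v

-- `δP′-eq` and `δC′-eq` are carried over to the integers, where the terms added in them can be
-- subtracted again and `value n v` may be negative.
δP′+δC′-value : ∀ n {v} → v ≤ n → + cost n v ≡ + n + + 2 + + 2 * value n v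
δP′+δC′-value n {v} v≤n = begin
  + (δP′ v +ℕ δC′ m)
    ≡⟨ ℤ.pos-+ (δP′ v) (δC′ m) ⟩
  p + q
    ≡⟨ eq₁ p q (+ v) t ⟩
  (p + + v) + (q + + 2 * t) - + v - + 2 * t
    ≡⟨ cong₂ (λ a b → a + b - + v - + 2 * t) P Q ⟩
  + 2 * + C v + (+ m + + 2) - + v - + 2 * t
    ≡⟨ eq₂ (+ C v) (+ m) (+ v) t ⟩
  (+ m + + v) + + 2 + + 2 * value n v
    ≡⟨ cong (λ k → k + + 2 + + 2 * value n v) (trans (sym (ℤ.pos-+ m v)) (cong +_ (m∸n+n≡m v≤n))) ⟩
  + n + + 2 + + 2 * value n v ∎
  where
  open ≡-Reasoning
  m = n ∸ v
  p = + δP′ v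
  q = + δC′ m
  t = + T m
  P : p + + v ≡ + 2 * + C v
  P = trans (sym (ℤ.pos-+ (δP′ v) v)) (trans (cong +_ (δP′-eq v)) (ℤ.pos-* 2 (C v)))
  Q : q + + 2 * t ≡ + m + + 2
  Q = trans (cong (λ k → q + k) (sym (ℤ.pos-* 2 (T m))))
        (trans (sym (ℤ.pos-+ (δC′ m) _)) (trans (cong +_ (δC′-eq m)) (ℤ.pos-+ m 2)))
  eq₁ : ∀ p q v t → p + q ≡ (p + v) + (q + + 2 * t) - v - + 2 * t
  eq₁ = ℤ-Solver.solve-∀
  eq₂ : ∀ c m v t → + 2 * c + (m + + 2) - v - + 2 * t ≡
                    (m + v) + + 2 + + 2 * (c - t - v)
  eq₂ = ℤ-Solver.solve-∀

affine-mono : ∀ n {x y} → x ℤ.≤ y → + n + + 2 + + 2 * x ℤ.≤ + n + + 2 + + 2 * y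
affine-mono n p = ℤ.+-monoʳ-≤ (+ n + + 2) (ℤ.*-monoˡ-≤-nonNeg (+ 2) p)

-- The cost is an increasing affine function of `value n`, so each minimum is compared with the
-- other at the other's minimiser.
δ′-value : ∀ n → + δ′ n ≡ + n + + 2 + + 2 * min≤ℤ n (value n)
δ′-value n with min≤-attained n (cost n) | min≤ℤ-attained n (value n)
... | v , v≤n , eqv | w , w≤n , eqw = ℤ.≤-antisym
  (begin
    + δ′ n                                       ≤⟨ ℤ.+≤+ (min≤-≤ n (cost n) w≤n) ⟩
    + cost n w                      ≡⟨ δP′+δC′-value n w≤n ⟩
    + n + + 2 + + 2 * value n w            ≡⟨ cong (λ k → + n + + 2 + + 2 * k) (sym eqw) ⟩
    + n + + 2 + + 2 * min≤ℤ n (value n)    ∎)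
  (begin
    + n + + 2 + + 2 * min≤ℤ n (value n)    ≤⟨ affine-mono n (min≤ℤ-≤ n (value n) v≤n) ⟩
    + n + + 2 + + 2 * value n v            ≡⟨ sym (δP′+δC′-value n v≤n) ⟩
    + cost n v                      ≡⟨ cong +_ (sym eqv) ⟩
    + δ′ n                                       ∎)
  where open ℤ.≤-Reasoning

theorem3p14 : Σ CutMinima λ M → let open CutMinima M in
    ∀ (n : ℕ) → 1 ≤ n →
    (δ n ≡ min≤ n (λ v → δP v +ℕ δC (n ∸ v))) ×
    (+ δ n ≡ + n + + 2 + + 2 * min≤ℤ n (λ v → + C v - + T (n ∸ v) - + v))
theorem3p14 = cutMinima , λ n _ → refl , δ′-value n
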